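{- For every integer $r\geq 3$ there exists $n_0$ such that for all integers $n>n_0$ the following holds. For every set $A\subseteq [n]$ with $|A|\geq (1-r^{ -3})n$, the number of rainbow sum-free $r$-colorings of $A$ satisfies $$g(A,r)\leq \binom{r}{2}\cdot 2^{|A|}+2^{ -\frac{n}{26\log_2 n}}\,2^n.$$
   Context: $[n]=\{1,\dots,n\}$. An $r$-coloring of a set $A$ of positive integers is a map $f:A\to[r]$. A rainbow sum in a colored set is a triple of three distinct elements $x,y,z$ with $x+y=z$ that receive three different colors. An $r$-coloring is rainbow sum-free if it contains no rainbow sum. $g(A,r)$ denotes the number of rainbow sum-free $r$-colorings of $A$. -}

module Defs where

open import Data.Nat using (ℕ; zero; suc; _+_; _*_; _∸_; _^_; _≤_; _<_)
import Data.Nat.Properties as ℕP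
open import Data.Fin using (Fin; toℕ)
import Data.Fin.Properties as FinP
open import Data.Fin.Subset using (Subset; _∈_)
open import Data.Fin.Subset.Properties using (_∈?_)
open import Data.Bool using (true; false)
open import Data.Maybe using (Maybe; just; nothing)
import Data.Maybe.Properties as MaybeP
open import Data.Vec using (Vec; []; _∷_; lookup)
open import Data.List using (List; [_]; map; concatMap; allFin; filter; length)
open import Data.Product using (_×_)
open import Relation.Binary.PropositionalEquality using (_≡_; _≢_)
open import Relation.Nullary using (¬_; Dec)
open import Relation.Nullary.Decidable using (_×-dec_; _→-dec_; ¬?)

-- A subset A ⊆ [n] is a 'Subset n'; the element i : Fin n represents the
-- positive integer  toℕ i + 1 .
val : {n : ℕ} → Fin n → ℕ
val i = suc (toℕ i)

-- An r-coloring of A ⊆ [n] is encoded as a vector of length n whose entry at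
-- position i is  just (colour of i)  if i ∈ A  and  nothing  if i ∉ A.
-- 'colorings r A' is the list of ALL r-colorings of A (each exactly once).
colorings : (r : ℕ) → {n : ℕ} → Subset n → List (Vec (Maybe (Fin r)) n)
colorings r []          = [ [] ]
colorings r (true ∷ A)  = concatMap (λ v → map (λ a → just a ∷ v) (allFin r)) (colorings r A)
colorings r (false ∷ A) = map (nothing ∷_) (colorings r A)

ThreeColours : {r : ℕ} → Maybe (Fin r) → Maybe (Fin r) → Maybe (Fin r) → Set
ThreeColours a b c = a ≢ b × b ≢ c × a ≢ c

RainbowSumFree : {r n : ℕ} → Subset n → Vec (Maybe (Fin r)) n → Set
RainbowSumFree {r} {n} A c =
  (x y z : Fin n) → x ∈ A → y ∈ A → z ∈ A →
  x ≢ y → y ≢ z → x ≢ z → val x + val y ≡ val z →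
  ¬ ThreeColours (lookup c x) (lookup c y) (lookup c z)

rainbowSumFree? : {r n : ℕ} (A : Subset n) (c : Vec (Maybe (Fin r)) n) → Dec (RainbowSumFree A c)
rainbowSumFree? {r} {n} A c =
  FinP.all? λ x → FinP.all? λ y → FinP.all? λ z →
    (x ∈? A) →-dec (y ∈? A) →-dec (z ∈? A) →-dec
    ¬? (x FinP.≟ y) →-dec ¬? (y FinP.≟ z) →-dec ¬? (x FinP.≟ z) →-dec
    (val x + val y ℕP.≟ val z) →-dec
    ¬? (¬? (eq (lookup c x) (lookup c y)) ×-dec ¬? (eq (lookup c y) (lookup c z))
         ×-dec ¬? (eq (lookup c x) (lookup c z)))
  where eq = MaybeP.≡-dec FinP._≟_

g : {n : ℕ} → Subset n → (r : ℕ) → ℕ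
g A r = length (filter (rainbowSumFree? A) (colorings r A))

-- 'BoundByPow n E'  expresses the real inequality
--      E ≤ 2^( n - n / (26 · log₂ n) )      (i.e. E ≤ 2^(-n/(26 log₂ n)) · 2^n)
-- for a natural number E, without real numbers. Since the right-hand side is
-- continuous and increasing in the value  log₂ n , the inequality holds iff for
-- every rational  p/q > log₂ n  (i.e. q > 0 and n^q < 2^p) we have
--      E ≤ 2^( n - n q / (26 p) ),
-- i.e. (raising to the power 26p > 0)  E^(26p) · 2^(n q) ≤ 2^(26 p n).
BoundByPow : ℕ → ℕ → Set
BoundByPow n E =
  (p q : ℕ) → 0 < q → n ^ q < 2 ^ p → E ^ (26 * p) * 2 ^ (n * q) ≤ 2 ^ (26 * p * n)

-- 'x ≤ K + 2^(-n/(26 log₂ n)) 2^n'  for naturals x, K  is equivalent to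
-- '(x ∸ K) ≤ 2^(-n/(26 log₂ n)) 2^n'  (the right summand is nonnegative).
LeWithError : ℕ → ℕ → ℕ → Set
LeWithError n x K = BoundByPow n (x ∸ K)

-- Call a pair (i , a) of a position and a colour a vertex; a rainbow sum is an edge of a 3-uniform hypergraph on
-- these vertices in which any two vertices lie in at most 3r edges, and a rainbow sum-free colouring is an
-- independent set. A branching procedure keeps a set P of allowed and a set F of forced vertices. It branches on
-- whether a vertex that forms many edges with F is used (if so, many vertices become forbidden), or on whether a
-- vertex w outside F that lies in at least εn edges inside P is used (if so, w joins F, which happens a bounded
-- number of times). This has at most 2^(δn) leaves, with δ small, so it suffices to bound the number of
-- colourings that use at least three colours at one leaf.
--
-- At a leaf, unforced vertices of P lie in few edges. Pairing every u with |u − w| then shows: if three colours are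
-- available at some w, almost every position has at most one colour. Otherwise every position has at most two
-- colours, and if almost all positions have two, these are almost always the same two, b₁ and b₂. A third colour
-- available at some w must be forced there, and then u and |u − w| must receive the same one of b₁ and b₂, which
-- halves the number of choices for linearly many disjoint pairs.

module Submission where

open import Defs
open import Data.Bool using (true; false)
open import Data.Fin.Subset using (Subset; ∣_∣; _∈_)
open import Data.Fin.Subset.Properties using (_∈?_)
open import Data.Maybe using (Maybe; just; nothing)
open import Data.Maybe.Properties using (just-injective) renaming (≡-dec to ≡-decMaybe)
open import Data.Vec using (Vec; []; _∷_; lookup; here; there)
open import Data.Nat.Combinatorics using (_C_; nC1≡n; nCk+nC[k+1]≡[n+1]C[k+1])
open import Data.Nat using (ℕ; zero; suc; _+_; _*_; _∸_; _^_; pred; _≤_; _<_; _≥_; z≤n; s≤s; NonZero; >-nonZero)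
open import Data.Nat.Properties hiding (suc-injective)
open import Data.Nat.DivMod using (_/_; _%_; m*n/n≡m; /-monoˡ-≤; m/n*n≤m; m≡m%n+[m/n]*n; m%n<n)
open import Data.Nat.Solver using (module +-*-Solver)
open import Data.Fin using (Fin; zero; suc; toℕ; fromℕ<; _↑ˡ_; _↑ʳ_; combine; quotient; remainder)
open import Data.Fin.Properties using (all?; any?; suc-injective; toℕ-injective; toℕ<n; toℕ-fromℕ<; remQuot-combine)
  renaming (_≟_ to _≟F_)
open import Data.Product using (∃; ∃-syntax; _×_; _,_; proj₁; proj₂)
open import Data.Sum using (_⊎_; inj₁; inj₂)
open import Data.Empty using (⊥)
open import Data.Unit using (⊤; tt)
open import Data.List using (List; []; _∷_; _++_; map; concatMap; tabulate; allFin; filter; length)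
open import Data.List.Properties
  using (filter-++; length-++; length-map; length-tabulate; map-tabulate; length-filter; filter-all; filter-accept; filter-reject)
open import Data.List.Membership.Propositional using () renaming (_∈_ to _∈ˡ_)
open import Data.List.Membership.Propositional.Properties
  using (∈-map⁻; ∈-map⁺; ∈-concatMap⁻; ∈-++⁺ˡ; ∈-++⁺ʳ; ∈-allFin; ∈-filter⁻)
open import Data.List.Relation.Unary.Any using (Any; here; there)
open import Data.List.Relation.Unary.All using (All; []; _∷_) renaming (lookup to lookupAll; tabulate to tabulateAll; all? to all-dec?)
open import Relation.Nullary using (¬_; Dec; yes; no; contradiction)
open import Relation.Nullary.Decidable using (_×-dec_; _→-dec_; _⊎-dec_; ¬?)
open import Relation.Unary using (Pred; Decidable)
open import Relation.Binary.PropositionalEquality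
  using (_≡_; _≢_; refl; sym; trans; cong; cong₂; subst; subst₂)
open import Relation.Binary.Definitions using (tri<; tri≈; tri>)
open import Function using (_∘_; id; case_of_)
open import Level using (0ℓ)
open import Algebra.Properties.Semiring.Sum +-*-semiring
  using (sum; ∑-distrib-+; ∑-comm; sum-cong-≗; *-distribʳ-sum)

private variable
  n m r : ℕ
  A B E : Set

-- Indicators and counting on `Fin n`

𝟙 : Dec A → ℕ
𝟙 (yes _) = 1
𝟙 (no _) = 0

𝟙≤1 : (a : Dec A) → 𝟙 a ≤ 1
𝟙≤1 (yes _) = s≤s z≤n
𝟙≤1 (no _)  = z≤n

𝟙-≤-+ : (a : Dec A) (b : Dec B) (c : Dec E) → (A → B ⊎ E) → 𝟙 a ≤ 𝟙 b + 𝟙 c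
𝟙-≤-+ (no _)  b       c       f = z≤n
𝟙-≤-+ (yes a) (yes _) c       f = s≤s z≤n
𝟙-≤-+ (yes a) (no _)  (yes _) f = s≤s z≤n
𝟙-≤-+ (yes a) (no ¬b) (no ¬c) f with f a
... | inj₁ b = contradiction b ¬b
... | inj₂ c = contradiction c ¬c

𝟙-+-≤ : (a : Dec A) (b : Dec B) (c : Dec E) → (B → A) → (E → A) → (B → ¬ E) → 𝟙 b + 𝟙 c ≤ 𝟙 a
𝟙-+-≤ a (no _) (no _) f g h = z≤n
𝟙-+-≤ (yes _) (yes _) (no _) f g h = s≤s z≤n
𝟙-+-≤ (yes _) (no _) (yes _) f g h = s≤s z≤n
𝟙-+-≤ a (yes b) (yes c) f g h = contradiction c (h b)
𝟙-+-≤ (no ¬a) (yes b) (no _) f g h = contradiction (f b) ¬a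
𝟙-+-≤ (no ¬a) (no _) (yes c) f g h = contradiction (g c) ¬a

𝟙-mono : (a : Dec A) (b : Dec B) → (A → B) → 𝟙 a ≤ 𝟙 b
𝟙-mono (no _)  b       f = z≤n
𝟙-mono (yes a) (yes _) f = s≤s z≤n
𝟙-mono (yes a) (no ¬b) f = contradiction (f a) ¬b

𝟙-yes : (a : Dec A) → A → 𝟙 a ≡ 1
𝟙-yes (yes _) _ = refl
𝟙-yes (no ¬a) a = contradiction a ¬a

𝟙-no : (a : Dec A) → ¬ A → 𝟙 a ≡ 0
𝟙-no (yes a) ¬a = contradiction a ¬a
𝟙-no (no _) _ = refl

sum-mono : (f g : Fin n → ℕ) → (∀ i → f i ≤ g i) → sum f ≤ sum g
sum-mono {zero}  f g h = z≤n
sum-mono {suc n} f g h = +-mono-≤ (h zero) (sum-mono (f ∘ suc) (g ∘ suc) (h ∘ suc))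

sum-≤-+ : (f g k : Fin n → ℕ) → (∀ i → f i ≤ g i + k i) → sum f ≤ sum g + sum k
sum-≤-+ f g k h = ≤-trans (sum-mono f _ h) (≤-reflexive (∑-distrib-+ g k))

sum-+-≤ : (f g k : Fin n → ℕ) → (∀ i → g i + k i ≤ f i) → sum g + sum k ≤ sum f
sum-+-≤ f g k h = ≤-trans (≤-reflexive (sym (∑-distrib-+ g k))) (sum-mono _ f h)

sum-≤-const : (f : Fin n → ℕ) (c : ℕ) → (∀ i → f i ≤ c) → sum f ≤ n * c
sum-≤-const {zero}  f c h = z≤n
sum-≤-const {suc n} f c h = +-mono-≤ (h zero) (sum-≤-const (f ∘ suc) c (h ∘ suc))

sum-≥-const : (f : Fin n → ℕ) (c : ℕ) → (∀ i → c ≤ f i) → n * c ≤ sum f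
sum-≥-const {zero}  f c h = z≤n
sum-≥-const {suc n} f c h = +-mono-≤ (h zero) (sum-≥-const (f ∘ suc) c (h ∘ suc))

term≤sum : (f : Fin n → ℕ) (i : Fin n) → f i ≤ sum f
term≤sum f zero    = m≤m+n _ _
term≤sum f (suc i) = ≤-trans (term≤sum (f ∘ suc) i) (m≤n+m _ _)

sum-zero : (f : Fin n → ℕ) → (∀ i → f i ≡ 0) → sum f ≡ 0
sum-zero {zero}  f h = refl
sum-zero {suc n} f h = cong₂ _+_ (h zero) (sum-zero (f ∘ suc) (h ∘ suc))

sum-splitAt : (m : ℕ) (f : Fin (m + n) → ℕ) → sum f ≡ sum (f ∘ (_↑ˡ n)) + sum (f ∘ (m ↑ʳ_))
sum-splitAt zero    f = refl
sum-splitAt (suc m) f = trans (cong (f zero +_) (sum-splitAt m (f ∘ suc))) (sym (+-assoc (f zero) _ _))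

sum-combine : (f : Fin (n * r) → ℕ) → sum f ≡ sum λ (i : Fin n) → sum λ (a : Fin r) → f (combine i a)
sum-combine {zero} f = refl
sum-combine {suc n} {r} f = trans (sum-splitAt r f) (cong (sum (f ∘ (_↑ˡ (n * r))) +_) (sum-combine {n} (f ∘ (r ↑ʳ_))))

count : {P : Pred (Fin n) 0ℓ} → Decidable P → ℕ
count P? = sum λ i → 𝟙 (P? i)

module _ {P Q : Pred (Fin n) 0ℓ} (P? : Decidable P) (Q? : Decidable Q) where

  count-mono : (∀ i → P i → Q i) → count P? ≤ count Q?
  count-mono f = sum-mono _ _ λ i → 𝟙-mono (P? i) (Q? i) (f i)

  module _ {R : Pred (Fin n) 0ℓ} (R? : Decidable R) where

    count-≤-+ : (∀ i → P i → Q i ⊎ R i) → count P? ≤ count Q? + count R?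
    count-≤-+ f = sum-≤-+ _ _ _ λ i → 𝟙-≤-+ (P? i) (Q? i) (R? i) (f i)

    count-+-≤ : (∀ i → Q i → P i) → (∀ i → R i → P i) → (∀ i → Q i → ¬ R i) →
                count Q? + count R? ≤ count P?
    count-+-≤ f g h = sum-+-≤ _ _ _ λ i → 𝟙-+-≤ (P? i) (Q? i) (R? i) (f i) (g i) (h i)

module _ {P : Pred (Fin n) 0ℓ} (P? : Decidable P) where

  count-none : (∀ i → ¬ P i) → count P? ≡ 0
  count-none h = sum-zero _ λ i → 𝟙-no (P? i) (h i)

  count-≥1 : (i : Fin n) → P i → 1 ≤ count P?
  count-≥1 i p = ≤-trans (≤-reflexive (sym (𝟙-yes (P? i) p))) (term≤sum _ i)

  count-witness : 0 < count P? → ∃ P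
  count-witness 0<c with any? P?
  ... | yes w = w
  ... | no ¬w = contradiction (count-none λ i p → ¬w (i , p)) (>⇒≢ 0<c)

count-≤1 : {P : Pred (Fin n) 0ℓ} (P? : Decidable P) → (∀ i j → P i → P j → i ≡ j) → count P? ≤ 1
count-≤1 {zero}  P? h = z≤n
count-≤1 {suc n} P? h with P? zero
... | yes p = ≤-reflexive (cong suc (count-none (P? ∘ suc) λ i q → case h zero (suc i) p q of λ ()))
... | no  _ = count-≤1 (P? ∘ suc) λ i j p q → suc-injective (h _ _ p q)

count-complement : {P : Pred (Fin n) 0ℓ} (P? : Decidable P) → n ≤ count P? + count (¬? ∘ P?)
count-complement {n} P? = ≤-trans (≤-reflexive (sym (*-identityʳ n)))
  (≤-trans (sum-≥-const _ 1 λ i → lem (P? i)) (≤-reflexive (∑-distrib-+ (𝟙 ∘ P?) _)))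
  where
  lem : ∀ {A} (a : Dec A) → 1 ≤ 𝟙 a + 𝟙 (¬? a)
  lem (yes _) = s≤s z≤n
  lem (no  _) = s≤s z≤n

count-+-complement≤ : {P : Pred (Fin n) 0ℓ} (P? : Decidable P) → count P? + count (¬? ∘ P?) ≤ n
count-+-complement≤ {n} P? = ≤-trans (sum-+-≤ (λ _ → 1) _ _ (λ i → lem (P? i)))
  (≤-trans (sum-≤-const {n} _ 1 λ _ → ≤-refl) (≤-reflexive (*-identityʳ n)))
  where
  lem : ∀ {A} (a : Dec A) → 𝟙 a + 𝟙 (¬? a) ≤ 1
  lem (yes _) = s≤s z≤n
  lem (no  _) = s≤s z≤n

module _ {P : Pred (Fin n) 0ℓ} (P? : Decidable P) where

  _∖_ : (i : Fin n) → Decidable (λ j → P j × j ≢ i)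
  _∖_ i j = P? j ×-dec ¬? (j ≟F i)

  count-remove≤ : (i : Fin n) → count P? ≤ count (_∖_ i) + 1
  count-remove≤ i = ≤-trans (count-≤-+ P? (_∖_ i) (_≟F i) λ j p → split j p (j ≟F i))
    (+-monoʳ-≤ (count (_∖_ i)) (count-≤1 (_≟F i) λ j k p q → trans p (sym q)))
    where
    split : ∀ j → P j → Dec (j ≡ i) → (P j × j ≢ i) ⊎ j ≡ i
    split j p (yes e) = inj₂ e
    split j p (no ¬e) = inj₁ (p , ¬e)

  count-remove : (i : Fin n) → P i → count (_∖_ i) + 1 ≤ count P?
  count-remove i p = ≤-trans (+-monoʳ-≤ (count (_∖_ i)) (count-≥1 (_≟F i) i refl))
    (count-+-≤ P? (_∖_ i) (_≟F i) (λ j → proj₁) (λ j e → subst P (sym e) p) (λ j q → proj₂ q))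

  count-avoid₁ : 1 < count P? → ∀ i → ∃[ j ] P j × j ≢ i
  count-avoid₁ h i = count-witness (_∖_ i) (+-cancelʳ-≤ 1 _ _ (≤-trans h (count-remove≤ i)))

count-avoid₂ : {P : Pred (Fin n) 0ℓ} (P? : Decidable P) → 2 < count P? → ∀ i k → ∃[ j ] P j × j ≢ i × j ≢ k
count-avoid₂ P? h i k with count-avoid₁ (_∖_ P? i) (+-cancelʳ-≤ 1 _ _ (≤-trans h (count-remove≤ P? i))) k
... | j , (p , j≢i) , j≢k = j , p , j≢i , j≢k

-- The container algorithm

-- Here `M` is the number of allowed vertices, `S` the energy and `I` the remaining budget. Removing
-- `k` vertices lowers the right side by at most `2 * D′ * D * k + g * k`. This equals `X * k`,
-- which the left side loses as well; `X` is chosen for this balance.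
potential-step : ∀ X D D′ g M M′ k S S′ I I′ → X ≡ 2 * D′ * D + g → M′ + k ≤ M → S ≤ S′ + 2 * D′ * k →
                 I ≤ I′ + g * k → X * M ≤ I + D * S → X * M′ ≤ I′ + D * S′
potential-step X D D′ g M M′ k S S′ I I′ refl M≥ S≤ I≤ inv = +-cancelʳ-≤ (X * k) _ _ (begin
  X * M′ + X * k                             ≡⟨ *-distribˡ-+ X M′ k ⟨
  X * (M′ + k)                               ≤⟨ *-monoʳ-≤ X M≥ ⟩
  X * M                                      ≤⟨ inv ⟩
  I + D * S                                  ≤⟨ +-mono-≤ I≤ (*-monoʳ-≤ D S≤) ⟩
  (I′ + g * k) + D * (S′ + 2 * D′ * k)       ≡⟨ solve 6 (λ g k D D′ I′ S′ →
    (I′ :+ g :* k) :+ D :* (S′ :+ con 2 :* D′ :* k) := (I′ :+ D :* S′) :+ (con 2 :* D′ :* D :+ g) :* k)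
    refl g k D D′ I′ S′ ⟩
  (I′ + D * S′) + X * k                      ∎)
  where open ≤-Reasoning
        open +-*-Solver

-- With no budget left the invariant would require an energy above `2 * D′` per allowed vertex, but
-- degrees at most `D′` give at most `D′`.
potential-exhausted : ∀ X D D′ g M S → X ≡ 2 * D′ * D + g → 0 < g → 0 < M → S ≤ M * D′ → ¬ (X * M ≤ D * S)
potential-exhausted X D D′ g M S refl 0<g 0<M S≤ inv = <⇒≱ (begin-strict
  D * S               ≤⟨ *-monoʳ-≤ D S≤ ⟩
  D * (M * D′)        ≤⟨ m≤m+n _ _ ⟩
  D * (M * D′) + D * (M * D′) <⟨ m<m+n _ (*-mono-≤ 0<g 0<M) ⟩
  D * (M * D′) + D * (M * D′) + g * M ≡⟨ solve 4 (λ D M D′ g →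
    D :* (M :* D′) :+ D :* (M :* D′) :+ g :* M := (con 2 :* D′ :* D :+ g) :* M) refl D M D′ g ⟩
  X * M ∎) inv
  where open ≤-Reasoning
        open +-*-Solver

-- Lifts the induction hypothesis from `M′` to `M`: each missing vertex contributes a factor `t` on
-- the left and the larger `suc t` on the right.
weight-step : ∀ t B M M′ J N → M′ ≤ M → t ^ M′ * N ≤ suc t ^ (M′ + J) * B →
              t ^ suc M * N ≤ t * (suc t ^ (M + J) * B)
weight-step t B M M′ J N M′≤M ih with e , refl ← m≤n⇒∃[o]m+o≡n M′≤M = begin
  t * t ^ (M′ + e) * N                ≡⟨ cong (λ x → t * x * N) (^-distribˡ-+-* t M′ e) ⟩
  t * (t ^ M′ * t ^ e) * N            ≡⟨ solve 4 (λ t a b n → t :* (a :* b) :* n := t :* (b :* (a :* n))) refl t (t ^ M′) (t ^ e) N ⟩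
  t * (t ^ e * (t ^ M′ * N))          ≤⟨ *-monoʳ-≤ t (*-mono-≤ (^-monoˡ-≤ e (n≤1+n t)) ih) ⟩
  t * (suc t ^ e * (suc t ^ (M′ + J) * B)) ≡⟨ cong (t *_) (sym (*-assoc (suc t ^ e) _ B)) ⟩
  t * (suc t ^ e * suc t ^ (M′ + J) * B) ≡⟨ cong (λ x → t * (x * B)) (sym (^-distribˡ-+-* (suc t) e (M′ + J))) ⟩
  t * (suc t ^ (e + (M′ + J)) * B)    ≡⟨ cong (λ x → t * (suc t ^ x * B)) (solve 3 (λ e M J → e :+ (M :+ J) := M :+ e :+ J) refl e M′ J) ⟩
  t * (suc t ^ (M′ + e + J) * B)      ∎
  where open ≤-Reasoning
        open +-*-Solver

-- The branch that discards a vertex has weight `t`, the branch that spends a unit of `J` has weight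
-- 1, and the weights add up to `suc t`. This replaces a binomial count of the leaves by
-- `(suc t / t) ^ M * suc t ^ J`.
branch-sum : ∀ t B M J N N₁ N₂ → N ≤ N₁ + N₂ → t ^ suc M * N₁ ≤ t * (suc t ^ (M + suc J) * B) →
             t ^ suc M * N₂ ≤ suc t ^ (M + suc J) * B → t ^ suc M * N ≤ suc t ^ (suc M + suc J) * B
branch-sum t B M J N N₁ N₂ N≤ le₁ le₂ = begin
  t ^ suc M * N                         ≤⟨ *-monoʳ-≤ (t ^ suc M) N≤ ⟩
  t ^ suc M * (N₁ + N₂)                 ≡⟨ *-distribˡ-+ (t ^ suc M) N₁ N₂ ⟩
  t ^ suc M * N₁ + t ^ suc M * N₂       ≤⟨ +-mono-≤ le₁ le₂ ⟩
  t * (suc t ^ (M + suc J) * B) + suc t ^ (M + suc J) * B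
    ≡⟨ solve 3 (λ t a b → t :* (a :* b) :+ a :* b := (con 1 :+ t) :* a :* b) refl t (suc t ^ (M + suc J)) B ⟩
  suc t * suc t ^ (M + suc J) * B       ∎
  where open ≤-Reasoning
        open +-*-Solver

sum-drop : (f : Fin n → ℕ) (D : ℕ) {R : Pred (Fin n) 0ℓ} (R? : Decidable R) →
           (∀ i → f i ≤ D) → (∀ i → ¬ R i → f i ≡ 0) → sum f ≤ count R? * D
sum-drop f D R? f≤D f≡0 = ≤-trans (sum-mono f _ λ i → lem i (R? i))
                                  (≤-reflexive (sym (*-distribʳ-sum D (𝟙 ∘ R?))))
  where
  lem : ∀ i (d : Dec _) → f i ≤ 𝟙 d * D
  lem i (yes _) = ≤-trans (f≤D i) (≤-reflexive (sym (+-identityʳ D)))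
  lem i (no ¬r) = ≤-reflexive (f≡0 i ¬r)

-- In an edge h u v w the last vertex plays the role of the forced one: deg counts edges {u , v , w} with v allowed
-- and w forced, energy counts such edges with u and v allowed.
module Container
  {V : ℕ} {h : Fin V → Fin V → Fin V → Set} (h? : ∀ u v w → Dec (h u v w))
  (h-sym : ∀ u v w → h u v w → h v u w)
  (Δ : ℕ) (codeg : ∀ u w → count (λ v → h? u v w) ≤ Δ) (codeg′ : ∀ u v → count (h? u v) ≤ Δ)
  where

  deg : {P F : Pred (Fin V) 0ℓ} → Decidable P → Decidable F → Fin V → ℕ
  deg P? F? u = sum λ v → sum λ w → 𝟙 (P? v ×-dec F? w ×-dec h? u v w)

  energy : {P F : Pred (Fin V) 0ℓ} → Decidable P → Decidable F → ℕ
  energy P? F? = sum λ u → sum λ v → sum λ w → 𝟙 (P? u ×-dec P? v ×-dec F? w ×-dec h? u v w)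

  codegᵖ : {P : Pred (Fin V) 0ℓ} → Decidable P → Fin V → ℕ
  codegᵖ P? w = sum λ u → sum λ v → 𝟙 (P? u ×-dec P? v ×-dec h? u v w)

  -- These are the vertices that become forbidden once `u` is used, since `w` is used in any case.
  Neighbour : Pred (Fin V) 0ℓ → Fin V → Pred (Fin V) 0ℓ
  Neighbour F u v = ∃[ w ] F w × h u v w

  neighbour? : {F : Pred (Fin V) 0ℓ} → Decidable F → ∀ u → Decidable (Neighbour F u)
  neighbour? F? u v = any? λ w → F? w ×-dec h? u v w

  insert? : {F : Pred (Fin V) 0ℓ} → Decidable F → (w : Fin V) → Decidable (λ v → F v ⊎ v ≡ w)
  insert? F? w v = F? v ⊎-dec (v ≟F w)

  module _ {P P′ F : Pred (Fin V) 0ℓ} (P? : Decidable P) (P′? : Decidable P′) (F? : Decidable F) where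

    deg-mono : (∀ v → P′ v → P v) → ∀ u → deg P′? F? u ≤ deg P? F? u
    deg-mono P′⊆P u = sum-mono _ _ λ v → sum-mono _ _ λ w →
      𝟙-mono (P′? v ×-dec F? w ×-dec h? u v w) (P? v ×-dec F? w ×-dec h? u v w)
             λ (p , q) → P′⊆P v p , q

    module _ {R : Pred (Fin V) 0ℓ} (R? : Decidable R) (D : ℕ)
             (P⊆P′∪R : ∀ v → P v → P′ v ⊎ R v) (deg≤D : ∀ u → P u → deg P? F? u ≤ D) where

      private
        a : Fin V → Fin V → Fin V → ℕ
        a u v w = 𝟙 (R? u ×-dec P? u ×-dec P? v ×-dec F? w ×-dec h? u v w)
        b : Fin V → Fin V → Fin V → ℕ
        b u v w = 𝟙 (R? v ×-dec P? u ×-dec P? v ×-dec F? w ×-dec h? u v w)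

        a≤ : ∀ u → sum (λ v → sum (a u v)) ≤ D
        a≤ u with P? u
        ... | yes p = ≤-trans (sum-mono _ _ λ v → sum-mono _ _ λ w →
                        𝟙-mono (R? u ×-dec yes p ×-dec P? v ×-dec F? w ×-dec h? u v w)
                               (P? v ×-dec F? w ×-dec h? u v w) λ (_ , _ , q) → q) (deg≤D u p)
        ... | no ¬p = ≤-trans (≤-reflexive (sum-zero _ λ v → sum-zero _ λ w →
                        𝟙-no (R? u ×-dec no ¬p ×-dec P? v ×-dec F? w ×-dec h? u v w) λ (_ , p , _) → ¬p p)) z≤n

        Σa≤ : sum (λ u → sum λ v → sum (a u v)) ≤ count R? * D
        Σa≤ = sum-drop _ D R? a≤ λ u ¬r → sum-zero _ λ v → sum-zero _ λ w →
          𝟙-no (R? u ×-dec P? u ×-dec P? v ×-dec F? w ×-dec h? u v w) λ (r , _) → ¬r r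

        Σb≤ : sum (λ u → sum λ v → sum (b u v)) ≤ count R? * D
        Σb≤ = ≤-trans (≤-reflexive (∑-comm λ u v → sum (b u v)))
          (≤-trans (sum-mono _ _ λ v → sum-mono _ _ λ u → sum-mono _ _ λ w →
             𝟙-mono (R? v ×-dec P? u ×-dec P? v ×-dec F? w ×-dec h? u v w)
                    (R? v ×-dec P? v ×-dec P? u ×-dec F? w ×-dec h? v u w)
                    λ (r , p , p′ , f , e) → r , p′ , p , f , h-sym u v w e)
           Σa≤)

      -- An edge that is lost has its first or its second vertex in `R`; `a` and `b` count these two
      -- kinds. The degree bound controls `a`, and `h-sym` reduces `b` to `a`.
      energy-restrict : energy P? F? ≤ energy P′? F? + 2 * D * count R?
      energy-restrict = ≤-trans
        (sum-≤-+ _ _ _ λ u → sum-≤-+ _ _ _ λ v → sum-≤-+ _ _ _ λ w → pt u v w)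
        (+-monoʳ-≤ (energy P′? F?)
          (≤-trans (≤-reflexive (trans (sum-cong-≗ λ u → trans (sum-cong-≗ λ v → ∑-distrib-+ (a u v) (b u v))
                                                              (∑-distrib-+ (λ v → sum (a u v)) _))
                                       (∑-distrib-+ (λ u → sum λ v → sum (a u v)) _)))
            (≤-trans (+-mono-≤ Σa≤ Σb≤) (≤-reflexive (alg (count R?) D)))))
        where
        alg : ∀ c D → c * D + c * D ≡ 2 * D * c
        alg = solve 2 (λ c D → c :* D :+ c :* D := con 2 :* D :* c) refl
          where open +-*-Solver
        pt : ∀ u v w → 𝟙 (P? u ×-dec P? v ×-dec F? w ×-dec h? u v w) ≤
             𝟙 (P′? u ×-dec P′? v ×-dec F? w ×-dec h? u v w) + (a u v w + b u v w)
        pt u v w = ≤-trans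
          (𝟙-≤-+ x? (P′? u ×-dec P′? v ×-dec F? w ×-dec h? u v w) ((R? u ×-dec x?) ⊎-dec (R? v ×-dec x?)) split)
          (+-monoʳ-≤ _ (𝟙-≤-+ ((R? u ×-dec x?) ⊎-dec (R? v ×-dec x?)) (R? u ×-dec x?) (R? v ×-dec x?) id))
          where
          x? = P? u ×-dec P? v ×-dec F? w ×-dec h? u v w
          split : P u × P v × F w × h u v w →
                  (P′ u × P′ v × F w × h u v w) ⊎ ((R u × P u × P v × F w × h u v w) ⊎ (R v × P u × P v × F w × h u v w))
          split x@(pu , pv , q) with P⊆P′∪R u pu | P⊆P′∪R v pv
          ... | inj₁ y | inj₁ z = inj₁ (y , z , q)
          ... | inj₂ y | _      = inj₂ (inj₁ (y , x))
          ... | inj₁ _ | inj₂ z = inj₂ (inj₂ (z , x))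

  module _ {P F : Pred (Fin V) 0ℓ} (P? : Decidable P) (F? : Decidable F) where

    energy≤ : ∀ D → (∀ u → P u → deg P? F? u ≤ D) → energy P? F? ≤ count P? * D
    energy≤ D deg≤D = sum-drop _ D P? bound zeroes
      where
      zeroes : ∀ u → ¬ P u → sum (λ v → sum λ w → 𝟙 (P? u ×-dec P? v ×-dec F? w ×-dec h? u v w)) ≡ 0
      zeroes u ¬p = sum-zero _ λ v → sum-zero _ λ w →
        𝟙-no (P? u ×-dec P? v ×-dec F? w ×-dec h? u v w) λ (p , _) → ¬p p
      bound : ∀ u → sum (λ v → sum λ w → 𝟙 (P? u ×-dec P? v ×-dec F? w ×-dec h? u v w)) ≤ D
      bound u = case P? u of λ where
        (yes p) → ≤-trans (sum-mono _ _ λ v → sum-mono _ _ λ w →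
                    𝟙-mono (P? u ×-dec P? v ×-dec F? w ×-dec h? u v w) (P? v ×-dec F? w ×-dec h? u v w) proj₂)
                    (deg≤D u p)
        (no ¬p) → ≤-trans (≤-reflexive (zeroes u ¬p)) z≤n

    -- A pair `u`, `v` lies in at most `Δ` edges, so a vertex of high degree forbids many vertices
    -- when it is used.
    deg≤neighbours : ∀ u → deg P? F? u ≤ count (λ v → P? v ×-dec neighbour? F? u v) * Δ
    deg≤neighbours u = sum-drop _ Δ (λ v → P? v ×-dec neighbour? F? u v)
      (λ v → ≤-trans (sum-mono _ _ λ w → 𝟙-mono (P? v ×-dec F? w ×-dec h? u v w) (h? u v w) λ (_ , _ , e) → e)
                     (codeg′ u v))
      (λ v ¬q → sum-zero _ λ w → 𝟙-no (P? v ×-dec F? w ×-dec h? u v w) λ (p , f , e) → ¬q (p , w , f , e))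

    module _ (w₀ : Fin V) (w∉F : ¬ F w₀) where

      deg-insert : ∀ u → deg P? (insert? F? w₀) u ≤ deg P? F? u + Δ
      deg-insert u = ≤-trans
        (sum-≤-+ _ _ _ λ v → sum-≤-+ _ _ (λ w → 𝟙 ((w ≟F w₀) ×-dec h? u v w₀)) λ w →
          𝟙-≤-+ (P? v ×-dec insert? F? w₀ w ×-dec h? u v w) (P? v ×-dec F? w ×-dec h? u v w)
                ((w ≟F w₀) ×-dec h? u v w₀)
                λ { (p , inj₁ f , e) → inj₁ (p , f , e) ; (p , inj₂ refl , e) → inj₂ (refl , e) })
        (+-monoʳ-≤ (deg P? F? u) (≤-trans (sum-mono _ _ λ v → one v) (codeg u w₀)))
        where
        one : ∀ v → sum (λ w → 𝟙 ((w ≟F w₀) ×-dec h? u v w₀)) ≤ 𝟙 (h? u v w₀)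
        one v with h? u v w₀
        ... | yes e = count-≤1 (λ w → (w ≟F w₀) ×-dec yes e) λ i j (p , _) (q , _) → trans p (sym q)
        ... | no ¬e = ≤-reflexive (count-none (λ w → (w ≟F w₀) ×-dec no ¬e) λ i (_ , e) → ¬e e)

      -- Since `w₀` was not forced before, none of its edges has been counted yet.
      energy-insert : energy P? F? + codegᵖ P? w₀ ≤ energy P? (insert? F? w₀)
      energy-insert = sum-+-≤ _ _ _ λ u → sum-+-≤ _ _ _ λ v → ≤-trans
        (+-monoʳ-≤ (sum λ w → 𝟙 (P? u ×-dec P? v ×-dec F? w ×-dec h? u v w))
          (≤-trans (𝟙-mono (P? u ×-dec P? v ×-dec h? u v w₀) (P? u ×-dec P? v ×-dec (w₀ ≟F w₀) ×-dec h? u v w₀)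
                     λ (p , q , e) → p , q , refl , e)
                   (term≤sum (λ w → 𝟙 (P? u ×-dec P? v ×-dec (w ≟F w₀) ×-dec h? u v w)) w₀)))
        (sum-+-≤ _ _ _ λ w → 𝟙-+-≤ (P? u ×-dec P? v ×-dec insert? F? w₀ w ×-dec h? u v w)
          (P? u ×-dec P? v ×-dec F? w ×-dec h? u v w) (P? u ×-dec P? v ×-dec (w ≟F w₀) ×-dec h? u v w)
          (λ (p , q , f , e) → p , q , inj₁ f , e) (λ (p , q , f , e) → p , q , inj₂ f , e)
          λ { (_ , _ , f , _) (_ , _ , refl , _) → w∉F f })

  -- `N P? F?` stands for the number of family members that use all of `F` and nothing outside `P`.
  -- A leaf is a state in which every allowed, unforced vertex has codegree below `g` in `P`.
  module Count
    (N : {P F : Pred (Fin V) 0ℓ} → Decidable P → Decidable F → ℕ)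
    (branch-use : ∀ {P F : Pred (Fin V) 0ℓ} (P? : Decidable P) (F? : Decidable F) u →
       N P? F? ≤ N (P? ∖ u) F? + N (λ v → P? v ×-dec ¬? (neighbour? F? u v)) F?)
    (branch-fix : ∀ {P F : Pred (Fin V) 0ℓ} (P? : Decidable P) (F? : Decidable F) w →
       N P? F? ≤ N (P? ∖ w) F? + N P? (insert? F? w))
    (D g t B : ℕ) (0<Δ : 0 < Δ) (0<D : 0 < D) (0<g : 0 < g)
    (leaf : ∀ {P F : Pred (Fin V) 0ℓ} (P? : Decidable P) (F? : Decidable F) →
       (∀ w → P w → ¬ F w → codegᵖ P? w < g) → N P? F? ≤ B)
    where

    private
      -- A vertex is forced only while all allowed degrees are below `Δ * D`, and forcing adds at
      -- most `Δ` to each, so `D′` bounds the degrees throughout.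
      D′ = Δ * suc D
      X = 2 * D′ * D + g

      grow : ∀ M J x → t * (suc t ^ (M + J) * x) ≤ suc t ^ (M + suc J) * x
      grow M J x = begin
        t * (suc t ^ (M + J) * x)       ≤⟨ *-monoˡ-≤ _ (n≤1+n t) ⟩
        suc t * (suc t ^ (M + J) * x)   ≡⟨ *-assoc (suc t) (suc t ^ (M + J)) x ⟨
        suc t ^ (suc M + J) * x         ≡⟨ cong (λ e → suc t ^ e * x) (sym (+-suc M J)) ⟩
        suc t ^ (M + suc J) * x         ∎
        where open ≤-Reasoning

      drop-one : ∀ {M M′ e} → M′ + e ≤ suc M → 1 ≤ e → M′ ≤ M
      drop-one {M} {M′} M′+e≤ 1≤e = ≤-pred (≤-trans (≤-reflexive (+-comm 1 M′)) (≤-trans (+-monoʳ-≤ M′ 1≤e) M′+e≤))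

      spend : ∀ J k → D ≤ k → suc J * (D * g) ≤ J * (D * g) + g * k
      spend J k D≤k = ≤-trans (≤-reflexive (trans (+-comm (D * g) _) (cong (J * (D * g) +_) (*-comm D g))))
                              (+-monoʳ-≤ (J * (D * g)) (*-monoʳ-≤ g D≤k))

    -- J bounds the number of steps that force a vertex or delete a neighbourhood. Forcing raises the energy by at
    -- least g, deleting a vertex lowers it by at most 2D′, and a deleted neighbourhood has at least D vertices, so
    -- the inequality with X survives every step and prevents J from running out.
    container : ∀ k {P F : Pred (Fin V) 0ℓ} (P? : Decidable P) (F? : Decidable F) J → count P? + J ≤ k →
      (∀ u → P u → deg P? F? u ≤ D′) → X * count P? ≤ J * (D * g) + D * energy P? F? →
      t ^ count P? * N P? F? ≤ suc t ^ (count P? + J) * B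
    container k P? F? J fuel deg≤ inv
      with any? (λ u → P? u ×-dec (Δ * D ≤? deg P? F? u))
         | any? (λ w → P? w ×-dec ¬? (F? w) ×-dec (g ≤? codegᵖ P? w))
    ... | no low | no light = *-mono-≤ (≤-trans (^-monoˡ-≤ (count P?) (n≤1+n t)) (^-monoʳ-≤ (suc t) (m≤m+n (count P?) J)))
                                       (leaf P? F? λ w p ¬f → ≰⇒> λ g≤ → light (w , p , ¬f , g≤))
    ... | yes (u , p , high) | _ = go k (count P?) refl J fuel inv
      where
      R? = λ v → P? v ×-dec neighbour? F? u v
      P∖R? = λ v → P? v ×-dec ¬? (neighbour? F? u v)
      c-u : count (P? ∖ u) + count (_≟F u) ≤ count P?
      c-u = count-+-≤ P? (P? ∖ u) (_≟F u) (λ _ → proj₁) (λ { _ refl → p }) (λ _ → proj₂)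
      1≤δ : 1 ≤ count (_≟F u)
      1≤δ = count-≥1 (_≟F u) u refl
      c-R : count P∖R? + count R? ≤ count P?
      c-R = count-+-≤ P? P∖R? R? (λ _ → proj₁) (λ _ → proj₁) (λ _ q q′ → proj₂ q (proj₂ q′))
      D≤R : D ≤ count R?
      D≤R = *-cancelˡ-≤ Δ {{>-nonZero 0<Δ}} (≤-trans high (≤-trans (deg≤neighbours P? F? u) (≤-reflexive (*-comm _ Δ))))
      go : ∀ k M → count P? ≡ M → ∀ J → M + J ≤ k → X * M ≤ J * (D * g) + D * energy P? F? →
           t ^ M * N P? F? ≤ suc t ^ (M + J) * B
      go k zero eq J fuel inv = contradiction (≤-trans (count-≥1 P? u p) (≤-reflexive eq)) λ ()
      go k (suc M) eq zero fuel inv = contradiction inv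
        (potential-exhausted X D D′ g (suc M) _ refl 0<g (s≤s z≤n) (subst (λ c → energy P? F? ≤ c * D′) eq (energy≤ P? F? D′ deg≤)))
      go (suc k) (suc M) eq (suc J) (s≤s fuel) inv = branch-sum t B M J _ _ _ (branch-use P? F? u)
        (weight-step t B M _ (suc J) _ M₁≤M (container k (P? ∖ u) F? (suc J) (≤-trans (+-monoˡ-≤ (suc J) M₁≤M) fuel)
           (λ v q → ≤-trans (deg-mono P? (P? ∖ u) F? (λ _ → proj₁) v) (deg≤ v (proj₁ q)))
           (potential-step X D D′ g (suc M) _ _ _ _ _ _ refl (≤-trans c-u (≤-reflexive eq))
             (energy-restrict P? (P? ∖ u) F? (_≟F u) D′ (λ v q → case v ≟F u of λ where
               (yes e) → inj₂ e
               (no ¬e) → inj₁ (q , ¬e)) deg≤) (m≤m+n _ _) inv)))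
        -- When `u` is used, `F` stays the same and the vertices forbidden by `u` leave `P`. There
        -- are at least `D` of them, which pays for one unit of `J`.
        (≤-trans (weight-step t B M _ J _ M₂≤M (container k P∖R? F? J (≤-trans (+-mono-≤ M₂≤M (n≤1+n J)) fuel)
           (λ v q → ≤-trans (deg-mono P? P∖R? F? (λ _ → proj₁) v) (deg≤ v (proj₁ q)))
           (potential-step X D D′ g (suc M) _ _ _ _ _ _ refl (≤-trans c-R (≤-reflexive eq))
             (energy-restrict P? P∖R? F? R? D′ (λ v q → case neighbour? F? u v of λ where
               (yes e) → inj₂ (q , e)
               (no ¬e) → inj₁ (q , ¬e)) deg≤) (spend J (count R?) D≤R) inv)))
           (grow M J B))
        where
        M₁≤M : count (P? ∖ u) ≤ M
        M₁≤M = drop-one (≤-trans c-u (≤-reflexive eq)) 1≤δ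
        M₂≤M : count P∖R? ≤ M
        M₂≤M = drop-one (≤-trans c-R (≤-reflexive eq)) (≤-trans 0<D D≤R)
    ... | no low | yes (w , p , w∉F , heavy) = go k (count P?) refl J fuel inv
      where
      c-w : count (P? ∖ w) + count (_≟F w) ≤ count P?
      c-w = count-+-≤ P? (P? ∖ w) (_≟F w) (λ _ → proj₁) (λ { _ refl → p }) (λ _ → proj₂)
      go : ∀ k M → count P? ≡ M → ∀ J → M + J ≤ k → X * M ≤ J * (D * g) + D * energy P? F? →
           t ^ M * N P? F? ≤ suc t ^ (M + J) * B
      go k zero eq J fuel inv = contradiction (≤-trans (count-≥1 P? w p) (≤-reflexive eq)) λ ()
      go k (suc M) eq zero fuel inv = contradiction inv
        (potential-exhausted X D D′ g (suc M) _ refl 0<g (s≤s z≤n) (subst (λ c → energy P? F? ≤ c * D′) eq (energy≤ P? F? D′ deg≤)))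
      go (suc k) (suc M) eq (suc J) (s≤s fuel) inv = branch-sum t B M J _ _ _ (branch-fix P? F? w)
        (weight-step t B M _ (suc J) _ M₁≤M (container k (P? ∖ w) F? (suc J) (≤-trans (+-monoˡ-≤ (suc J) M₁≤M) fuel)
           (λ v q → ≤-trans (deg-mono P? (P? ∖ w) F? (λ _ → proj₁) v) (deg≤ v (proj₁ q)))
           (potential-step X D D′ g (suc M) _ _ _ _ _ _ refl (≤-trans c-w (≤-reflexive eq))
             (energy-restrict P? (P? ∖ w) F? (_≟F w) D′ (λ v q → case v ≟F w of λ where
               (yes e) → inj₂ e
               (no ¬e) → inj₁ (q , ¬e)) deg≤) (m≤m+n _ _) inv)))
        -- Forcing `w` leaves `P` unchanged, so only `J` decreases; the gain of at least `g` in
        -- energy pays for it.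
        (subst₂ (λ a b → t ^ a * N P? (insert? F? w) ≤ suc t ^ b * B) eq (trans (cong (_+ J) eq) (sym (+-suc M J)))
          (container k P? (insert? F? w) J (≤-trans (≤-reflexive (trans (cong (_+ J) eq) (sym (+-suc M J)))) fuel)
            (λ v q → ≤-trans (deg-insert P? F? w w∉F v) (≤-trans (+-monoˡ-≤ Δ (<⇒≤ (≰⇒> λ le → low (v , q , le))))
                     (≤-reflexive (trans (+-comm _ Δ) (sym (*-suc Δ D))))))
            (≤-trans (subst (λ c → X * c ≤ suc J * (D * g) + D * energy P? F?) (sym eq) inv) gain)))
        where
        M₁≤M : count (P? ∖ w) ≤ M
        M₁≤M = drop-one (≤-trans c-w (≤-reflexive eq)) (count-≥1 (_≟F w) w refl)
        gain : suc J * (D * g) + D * energy P? F? ≤ J * (D * g) + D * energy P? (insert? F? w)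
        gain = ≤-trans (≤-reflexive (solve 4 (λ D g J S → (con 1 :+ J) :* (D :* g) :+ D :* S := J :* (D :* g) :+ D :* (S :+ g))
                                       refl D g J (energy P? F?)))
          (+-monoʳ-≤ (J * (D * g)) (*-monoʳ-≤ D (≤-trans (+-monoʳ-≤ (energy P? F?) heavy) (energy-insert P? F? w w∉F))))
          where open +-*-Solver

-- Counting in lists

length-filter-∷ : {X : Set} {P : Pred X 0ℓ} (P? : Decidable P) (x : X) (xs : List X) →
                  length (filter P? (x ∷ xs)) ≡ 𝟙 (P? x) + length (filter P? xs)
length-filter-∷ P? x xs with P? x
... | yes _ = refl
... | no _ = refl

module _ {X : Set} {P Q : Pred X 0ℓ} (P? : Decidable P) (Q? : Decidable Q) where

  filter-mono : (xs : List X) → (∀ {x} → x ∈ˡ xs → P x → Q x) → length (filter P? xs) ≤ length (filter Q? xs)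
  filter-mono []       f = z≤n
  filter-mono (x ∷ xs) f = subst₂ _≤_ (sym (length-filter-∷ P? x xs)) (sym (length-filter-∷ Q? x xs))
    (+-mono-≤ (𝟙-mono (P? x) (Q? x) (f (here refl))) (filter-mono xs (f ∘ there)))

  filter-≤-+ : {R : Pred X 0ℓ} (R? : Decidable R) (xs : List X) → (∀ {x} → x ∈ˡ xs → P x → Q x ⊎ R x) →
               length (filter P? xs) ≤ length (filter Q? xs) + length (filter R? xs)
  filter-≤-+ R? []       f = z≤n
  filter-≤-+ R? (x ∷ xs) f = begin
    length (filter P? (x ∷ xs))                                  ≡⟨ length-filter-∷ P? x xs ⟩
    𝟙 (P? x) + length (filter P? xs)
      ≤⟨ +-mono-≤ (𝟙-≤-+ (P? x) (Q? x) (R? x) (f (here refl))) (filter-≤-+ R? xs (f ∘ there)) ⟩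
    (𝟙 (Q? x) + 𝟙 (R? x)) + (length (filter Q? xs) + length (filter R? xs))
      ≡⟨ solve 4 (λ a b c d → (a :+ b) :+ (c :+ d) := (a :+ c) :+ (b :+ d)) refl
                (𝟙 (Q? x)) (𝟙 (R? x)) (length (filter Q? xs)) (length (filter R? xs)) ⟩
    (𝟙 (Q? x) + length (filter Q? xs)) + (𝟙 (R? x) + length (filter R? xs))
      ≡⟨ cong₂ _+_ (length-filter-∷ Q? x xs) (length-filter-∷ R? x xs) ⟨
    length (filter Q? (x ∷ xs)) + length (filter R? (x ∷ xs))    ∎
    where open ≤-Reasoning
          open +-*-Solver

module _ {X : Set} {P : Pred X 0ℓ} (P? : Decidable P) where

  filter-zero : (xs : List X) → (∀ {x} → x ∈ˡ xs → ¬ P x) → length (filter P? xs) ≡ 0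
  filter-zero []       f = refl
  filter-zero (x ∷ xs) f = trans (length-filter-∷ P? x xs)
    (cong₂ _+_ (𝟙-no (P? x) (f (here refl))) (filter-zero xs (f ∘ there)))

  filter-tabulate : (f : Fin n → X) → length (filter P? (tabulate f)) ≡ sum λ i → 𝟙 (P? (f i))
  filter-tabulate {zero}  f = refl
  filter-tabulate {suc n} f = trans (length-filter-∷ P? (f zero) _) (cong (𝟙 (P? (f zero)) +_) (filter-tabulate (f ∘ suc)))

  filter-concatMap : {Y : Set} {Q : Pred Y 0ℓ} (Q? : Decidable Q) (f : Y → List X) (k : ℕ) →
    (∀ y → length (filter P? (f y)) ≤ k) → (∀ y {x} → x ∈ˡ f y → P x → Q y) →
    (ys : List Y) → length (filter P? (concatMap f ys)) ≤ k * length (filter Q? ys)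
  filter-concatMap Q? f k le imp []       = z≤n
  filter-concatMap Q? f k le imp (y ∷ ys) = begin
    length (filter P? (f y ++ concatMap f ys))                      ≡⟨ cong length (filter-++ P? (f y) _) ⟩
    length (filter P? (f y) ++ filter P? (concatMap f ys))          ≡⟨ length-++ (filter P? (f y)) ⟩
    length (filter P? (f y)) + length (filter P? (concatMap f ys))  ≤⟨ +-mono-≤ head≤ (filter-concatMap Q? f k le imp ys) ⟩
    k * 𝟙 (Q? y) + k * length (filter Q? ys)                        ≡⟨ *-distribˡ-+ k (𝟙 (Q? y)) _ ⟨
    k * (𝟙 (Q? y) + length (filter Q? ys))                          ≡⟨ cong (k *_) (length-filter-∷ Q? y ys) ⟨
    k * length (filter Q? (y ∷ ys))                                 ∎
    where
    open ≤-Reasoning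
    head≤ : length (filter P? (f y)) ≤ k * 𝟙 (Q? y)
    head≤ with Q? y
    ... | yes _ = ≤-trans (le y) (≤-reflexive (sym (*-identityʳ k)))
    ... | no ¬q = ≤-trans (≤-reflexive (filter-zero (f y) λ m p → ¬q (imp y m p))) z≤n

  -- A union bound: the members with `T y` are split off one `y` at a time, at a cost of at most `K`
  -- each.
  filter-exceptions : {Y : Set} {T : Y → Pred X 0ℓ} (T? : ∀ y → Decidable (T y)) (K : ℕ) (xs : List X) (ys : List Y) →
    (∀ y → length (filter (T? y) xs) ≤ K) →
    length (filter P? xs) ≤ length ys * K + length (filter (λ x → P? x ×-dec all-dec? (λ y → ¬? (T? y x)) ys) xs)
  filter-exceptions T? K xs []       le = filter-mono P? _ xs λ _ p → p , []
  filter-exceptions {T = T} T? K xs (y ∷ ys) le = begin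
    length (filter P? xs)                ≤⟨ filter-exceptions T? K xs ys le ⟩
    length ys * K + length (filter R? xs) ≤⟨ +-monoʳ-≤ (length ys * K) (filter-≤-+ R? (T? y) R′? xs λ {x} _ → split x) ⟩
    length ys * K + (length (filter (T? y) xs) + length (filter R′? xs)) ≤⟨ +-monoʳ-≤ (length ys * K) (+-monoˡ-≤ _ (le y)) ⟩
    length ys * K + (K + length (filter R′? xs)) ≡⟨ solve 3 (λ a b c → a :+ (b :+ c) := (b :+ a) :+ c) refl (length ys * K) K _ ⟩
    length (y ∷ ys) * K + length (filter R′? xs) ∎
    where
    open ≤-Reasoning
    open +-*-Solver
    R? = λ x → P? x ×-dec all-dec? (λ y → ¬? (T? y x)) ys
    R′? = λ x → P? x ×-dec all-dec? (λ y → ¬? (T? y x)) (y ∷ ys)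
    split : ∀ x → P x × All (λ y → ¬ T y x) ys → T y x ⊎ (P x × All (λ y → ¬ T y x) (y ∷ ys))
    split x (p , a) with T? y x
    ... | yes t = inj₁ t
    ... | no ¬t = inj₂ (p , ¬t ∷ a)

-- Containers for a family of independent sets

module IndependentFamily
  {V : ℕ} {h : Fin V → Fin V → Fin V → Set} (h? : ∀ u v w → Dec (h u v w))
  (h-sym : ∀ u v w → h u v w → h v u w)
  (Δ : ℕ) (codeg : ∀ u w → count (λ v → h? u v w) ≤ Δ) (codeg′ : ∀ u v → count (h? u v) ≤ Δ)
  {X : Set} {Uses : X → Fin V → Set} (uses? : ∀ x v → Dec (Uses x v)) (L : List X)
  (independent : ∀ x u v w → x ∈ˡ L → h u v w → Uses x u → Uses x v → ¬ Uses x w)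
  where

  open Container h? h-sym Δ codeg codeg′

  Between : Pred (Fin V) 0ℓ → Pred (Fin V) 0ℓ → X → Set
  Between P F x = (∀ v → Uses x v → P v) × (∀ v → F v → Uses x v)

  between? : {P F : Pred (Fin V) 0ℓ} → Decidable P → Decidable F → Decidable (Between P F)
  between? P? F? x = all? (λ v → uses? x v →-dec P? v) ×-dec all? (λ v → F? v →-dec uses? x v)

  N : {P F : Pred (Fin V) 0ℓ} → Decidable P → Decidable F → ℕ
  N P? F? = length (filter (between? P? F?) L)

  -- A member that uses `u` also uses every forced `w`, so by independence it avoids every `v` that
  -- completes an edge with them.
  branch-use : ∀ {P F : Pred (Fin V) 0ℓ} (P? : Decidable P) (F? : Decidable F) u →
    N P? F? ≤ N (P? ∖ u) F? + N (λ v → P? v ×-dec ¬? (neighbour? F? u v)) F?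
  branch-use P? F? u = filter-≤-+ _ _ _ L λ {x} m (p , f) → case uses? x u of λ where
    (yes q) → inj₂ ((λ v q′ → p v q′ , λ (w , fw , e) → independent x u v w m e q q′ (f w fw)) , f)
    (no ¬q) → inj₁ ((λ v q → p v q , λ { refl → ¬q q }) , f)

  branch-fix : ∀ {P F : Pred (Fin V) 0ℓ} (P? : Decidable P) (F? : Decidable F) w →
    N P? F? ≤ N (P? ∖ w) F? + N P? (insert? F? w)
  branch-fix P? F? w = filter-≤-+ _ _ _ L λ {x} m (p , f) → case uses? x w of λ where
    (yes q) → inj₂ (p , λ { v (inj₁ e) → f v e ; v (inj₂ refl) → q })
    (no ¬q) → inj₁ ((λ v q → p v q , λ { refl → ¬q q }) , f)

  module _ (D g t B : ℕ) (0<Δ : 0 < Δ) (0<D : 0 < D) (0<g : 0 < g)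
    (leaf : ∀ {P F : Pred (Fin V) 0ℓ} (P? : Decidable P) (F? : Decidable F) →
       (∀ w → P w → ¬ F w → codegᵖ P? w < g) → N P? F? ≤ B) where

    -- The procedure starts with all vertices allowed and none forced. All degrees then vanish, and
    -- the initial invariant follows from the assumption on `J`.
    family-bound : ∀ J → (2 * (Δ * suc D) * D + g) * V ≤ J * (D * g) → t ^ V * length L ≤ suc t ^ (V + J) * B
    family-bound J budget = begin
      t ^ V * length L                ≡⟨ cong₂ (λ a b → t ^ a * b) (sym countAll) (sym (cong length (filter-all (between? all∈ none∈) {L}
                                           (tabulateAll λ _ → (λ _ _ → tt) , λ _ ())))) ⟩
      t ^ count all∈ * N all∈ none∈   ≤⟨ container _ all∈ none∈ J ≤-refl
                                           (λ u _ → ≤-trans (≤-reflexive (sum-zero _ λ v → sum-zero _ λ w →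
                                             𝟙-no (all∈ v ×-dec none∈ w ×-dec h? u v w) λ ())) z≤n)
                                           (≤-trans (≤-reflexive (cong ((2 * (Δ * suc D) * D + g) *_) countAll))
                                             (≤-trans budget (m≤m+n _ _))) ⟩
      suc t ^ (count all∈ + J) * B    ≡⟨ cong (λ a → suc t ^ (a + J) * B) countAll ⟩
      suc t ^ (V + J) * B             ∎
      where
      open ≤-Reasoning
      open Count N branch-use branch-fix D g t B 0<Δ 0<D 0<g leaf
      all∈ : Decidable {A = Fin V} (λ _ → ⊤)
      all∈ _ = yes tt
      none∈ : Decidable {A = Fin V} (λ _ → ⊥)
      none∈ _ = no id
      countAll : count all∈ ≡ V
      countAll = ≤-antisym (≤-trans (sum-≤-const {V} _ 1 λ _ → ≤-refl) (≤-reflexive (*-identityʳ V)))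
                           (≤-trans (≤-reflexive (sym (*-identityʳ V))) (sum-≥-const {V} _ 1 λ _ → ≤-refl))

-- Colourings

Colouring : ℕ → ℕ → Set
Colouring r n = Vec (Maybe (Fin r)) n

Within : (Fin n → Fin r → Set) → Colouring r n → Set
Within Q c = ∀ i a → lookup c i ≡ just a → Q i a

within? : {Q : Fin n → Fin r → Set} → (∀ i → Decidable (Q i)) → Decidable (Within Q)
within? Q? c = all? λ i → all? λ a → ≡-decMaybe _≟F_ (lookup c i) (just a) →-dec Q? i a

Coloured : Subset n → Colouring r n → Set
Coloured A c = (∀ i → i ∈ A → ∃[ a ] lookup c i ≡ just a) × (∀ i a → lookup c i ≡ just a → i ∈ A)

colorings-coloured : (A : Subset n) {c : Colouring r n} → c ∈ˡ colorings r A → Coloured A c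
colorings-coloured [] m = (λ ()) , λ ()
colorings-coloured {r = r} (true ∷ A) m with find-concatMap (colorings r A) (∈-concatMap⁻ (λ v → map (λ a → just a ∷ v) (allFin r)) m)
  where
  find-concatMap : ∀ {X Y : Set} {f : X → List Y} {y} (xs : List X) → Any (λ x → y ∈ˡ f x) xs → ∃[ x ] x ∈ˡ xs × y ∈ˡ f x
  find-concatMap (x ∷ xs) (here p) = x , here refl , p
  find-concatMap (x ∷ xs) (there p) with find-concatMap xs p
  ... | y , q , e = y , there q , e
... | v , v∈ , c∈ with a , _ , refl ← ∈-map⁻ _ c∈ with d , d′ ← colorings-coloured A v∈ =
  (λ { zero here → a , refl ; (suc i) (there q) → d i q }) ,
  (λ { zero b e → here ; (suc i) b e → there (d′ i b e) })
colorings-coloured (false ∷ A) m with v , v∈ , refl ← ∈-map⁻ _ m with d , d′ ← colorings-coloured A v∈ =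
  (λ { (suc i) (there q) → d i q }) , (λ { (suc i) b e → there (d′ i b e) })

-- Choices at different positions are independent, so the count is at most the product of the
-- numbers of available colours over `A`.
within-count : (A : Subset n) {Q : Fin n → Fin r → Set} (Q? : ∀ i → Decidable (Q i))
  {E : Pred (Fin n) 0ℓ} (E? : Decidable E) (k : ℕ) .{{_ : NonZero k}} →
  (∀ i → count (Q? i) ≤ k) → (∀ i → ¬ E i → count (Q? i) ≤ 1) →
  length (filter (within? Q?) (colorings r A)) ≤ k ^ count E?
within-count [] Q? E? k le₁ le₂ = length-filter (within? Q?) (colorings _ [])
within-count {suc n} {r} (true ∷ A) Q? E? k le₁ le₂ = begin
  length (filter (within? Q?) (concatMap (λ v → map (λ a → just a ∷ v) (allFin r)) (colorings r A)))
    ≤⟨ filter-concatMap (within? Q?) (within? (Q? ∘ suc)) _ (count (Q? zero)) head≤ tail∈ (colorings r A) ⟩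
  count (Q? zero) * length (filter (within? (Q? ∘ suc)) (colorings r A))
    ≤⟨ *-mono-≤ (pow (E? zero)) (within-count A (Q? ∘ suc) (E? ∘ suc) k (le₁ ∘ suc) (le₂ ∘ suc)) ⟩
  k ^ 𝟙 (E? zero) * k ^ count (E? ∘ suc) ≡⟨ ^-distribˡ-+-* k (𝟙 (E? zero)) _ ⟨
  k ^ (𝟙 (E? zero) + count (E? ∘ suc)) ∎
  where
  open ≤-Reasoning
  head≤ : ∀ v → length (filter (within? Q?) (map (λ a → just a ∷ v) (allFin r))) ≤ count (Q? zero)
  head≤ v = ≤-trans (≤-reflexive (trans (cong (length ∘ filter (within? Q?)) (map-tabulate id (λ a → just a ∷ v)))
                                        (filter-tabulate (within? Q?) (λ a → just a ∷ v))))
    (sum-mono _ _ λ a → 𝟙-mono (within? Q? (just a ∷ v)) (Q? zero a) λ w → w zero a refl)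
  tail∈ : ∀ v {c} → c ∈ˡ map (λ a → just a ∷ v) (allFin r) → Within _ c → Within _ v
  tail∈ v m w with _ , _ , refl ← ∈-map⁻ _ m = λ i → w (suc i)
  pow : (e : Dec _) → count (Q? zero) ≤ k ^ 𝟙 e
  pow (yes _) = ≤-trans (le₁ zero) (≤-reflexive (sym (*-identityʳ k)))
  pow (no ¬e) = le₂ zero ¬e
within-count {suc n} {r} (false ∷ A) Q? E? k le₁ le₂ = begin
  length (filter (within? Q?) (map (nothing ∷_) (colorings r A)))
    ≤⟨ filter-map (colorings r A) ⟩
  length (filter (within? (Q? ∘ suc)) (colorings r A))
    ≤⟨ within-count A (Q? ∘ suc) (E? ∘ suc) k (le₁ ∘ suc) (le₂ ∘ suc) ⟩
  -- Outside `A` the only entry is `nothing`, a factor of 1.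
  k ^ count (E? ∘ suc) ≤⟨ ^-monoʳ-≤ k (m≤n+m _ (𝟙 (E? zero))) ⟩
  k ^ (𝟙 (E? zero) + count (E? ∘ suc)) ∎
  where
  open ≤-Reasoning
  filter-map : ∀ vs → length (filter (within? Q?) (map (nothing ∷_) vs)) ≤ length (filter (within? (Q? ∘ suc)) vs)
  filter-map [] = z≤n
  filter-map (v ∷ vs) = subst₂ _≤_ (sym (length-filter-∷ (within? Q?) (nothing ∷ v) (map (nothing ∷_) vs)))
                                   (sym (length-filter-∷ (within? (Q? ∘ suc)) v vs))
    (+-mono-≤ (𝟙-mono (within? Q? (nothing ∷ v)) (within? (Q? ∘ suc) v) λ w i → w (suc i)) (filter-map vs))

count-∈ : (A : Subset n) → count (_∈? A) ≤ ∣ A ∣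
count-∈ [] = z≤n
count-∈ (true ∷ A) = s≤s (≤-trans (count-mono _ (_∈? A) λ { i (there p) → p }) (count-∈ A))
count-∈ (false ∷ A) = ≤-trans (count-mono _ (_∈? A) λ { i (there p) → p }) (count-∈ A)

count-∉ : (A : Subset n) → ∣ A ∣ + count (λ i → ¬? (i ∈? A)) ≤ n
count-∉ [] = z≤n
count-∉ (true ∷ A) = s≤s (≤-trans (+-monoʳ-≤ ∣ A ∣ (count-mono _ (λ i → ¬? (i ∈? A)) λ i ¬p p → ¬p (there p))) (count-∉ A))
count-∉ (false ∷ A) = ≤-trans (≤-trans (+-monoʳ-≤ ∣ A ∣ (s≤s (count-mono _ (λ i → ¬? (i ∈? A)) λ i ¬p p → ¬p (there p))))
                                       (≤-reflexive (+-suc ∣ A ∣ _))) (s≤s (count-∉ A))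

TwoColoured : Fin r × Fin r → Colouring r n → Set
TwoColoured (a , b) = Within λ _ d → d ≡ a ⊎ d ≡ b

twoColoured? : (p : Fin r × Fin r) → Decidable (TwoColoured {r} {n} p)
twoColoured? (a , b) = within? λ _ d → (d ≟F a) ⊎-dec (d ≟F b)

twoColoured-count : (A : Subset n) (p : Fin r × Fin r) → length (filter (twoColoured? p) (colorings r A)) ≤ 2 ^ ∣ A ∣
twoColoured-count {n} {r} A (a , b) = ≤-trans
  (filter-mono (twoColoured? (a , b)) (within? Q?) (colorings r A)
    λ m t i d e → proj₂ (colorings-coloured A m) i d e , t i d e)
  (≤-trans (within-count A Q? (_∈? A) 2
    (λ i → ≤-trans (count-≤-+ (Q? i) (_≟F a) (_≟F b) λ _ → proj₂)
             (+-mono-≤ (count-≤1 (_≟F a) λ _ _ p q → trans p (sym q)) (count-≤1 (_≟F b) λ _ _ p q → trans p (sym q))))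
    (λ i ∉ → ≤-trans (≤-reflexive (count-none (Q? i) λ _ q → ∉ (proj₁ q))) z≤n))
    (^-monoʳ-≤ 2 (count-∈ A)))
  where
  -- Requiring `i ∈ A` leaves no colour available outside `A`, so the exponent is `∣ A ∣` and not
  -- `n`.
  Q? : ∀ i → Decidable (λ (d : Fin r) → i ∈ A × (d ≡ a ⊎ d ≡ b))
  Q? i d = (i ∈? A) ×-dec ((d ≟F a) ⊎-dec (d ≟F b))

pairs : ∀ r → List (Fin r × Fin r)
pairs zero    = []
pairs (suc r) = map (λ b → zero , suc b) (allFin r) ++ map (λ (a , b) → suc a , suc b) (pairs r)

length-pairs : ∀ r → length (pairs r) ≡ r C 2
length-pairs zero    = refl
length-pairs (suc r) = begin
  length (pairs (suc r)) ≡⟨ length-++ (map _ (allFin r)) ⟩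
  length (map _ (allFin r)) + length (map _ (pairs r))
    ≡⟨ cong₂ _+_ (trans (length-map _ (allFin r)) (length-tabulate id)) (trans (length-map _ (pairs r)) (length-pairs r)) ⟩
  r + r C 2        ≡⟨ cong (_+ r C 2) (nC1≡n r) ⟨
  r C 1 + r C 2    ≡⟨ nCk+nC[k+1]≡[n+1]C[k+1] r 1 ⟩
  suc r C 2        ∎
  where open Relation.Binary.PropositionalEquality.≡-Reasoning

pairs-complete : (a b : Fin r) → a ≢ b → (a , b) ∈ˡ pairs r ⊎ (b , a) ∈ˡ pairs r
pairs-complete zero    zero    a≢b = contradiction refl a≢b
pairs-complete zero    (suc b) a≢b = inj₁ (∈-++⁺ˡ (∈-map⁺ _ (∈-allFin b)))
pairs-complete (suc a) zero    a≢b = inj₂ (∈-++⁺ˡ (∈-map⁺ _ (∈-allFin a)))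
pairs-complete {suc r} (suc a) (suc b) a≢b with pairs-complete a b (a≢b ∘ cong suc)
... | inj₁ p = inj₁ (∈-++⁺ʳ (map _ (allFin r)) (∈-map⁺ _ p))
... | inj₂ p = inj₂ (∈-++⁺ʳ (map _ (allFin r)) (∈-map⁺ _ p))

-- For `r ≥ 2` the second condition says that at least three colours occur.
multiColoured? : (A : Subset n) → Decidable λ (c : Colouring r n) → RainbowSumFree A c × All (λ p → ¬ TwoColoured p c) (pairs r)
multiColoured? {r = r} A c = rainbowSumFree? A c ×-dec all-dec? (λ p → ¬? (twoColoured? p c)) (pairs r)

-- Each pair of colours accounts for at most `2 ^ ∣ A ∣` colourings, which gives the main term; the
-- last summand is the error to be bounded.
g-≤ : (A : Subset n) (r : ℕ) → g A r ≤ (r C 2) * 2 ^ ∣ A ∣ + length (filter (multiColoured? A) (colorings r A))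
g-≤ A r = subst (λ k → g A r ≤ k * 2 ^ ∣ A ∣ + length (filter (multiColoured? A) (colorings r A))) (length-pairs r)
  (filter-exceptions (rainbowSumFree? A) twoColoured? (2 ^ ∣ A ∣) (colorings r A) (pairs r) (twoColoured-count A))

-- Sums and partners

count-⊎ : {P Q : Pred (Fin n) 0ℓ} (P? : Decidable P) (Q? : Decidable Q) →
          count (λ i → P? i ⊎-dec Q? i) ≤ count P? + count Q?
count-⊎ P? Q? = count-≤-+ _ P? Q? λ _ → id

count-∃ : {R : Fin n → Fin m → Set} (R? : ∀ i → Decidable (R i)) →
          count (λ i → any? (R? i)) ≤ sum λ j → count λ i → R? i j
count-∃ R? = ≤-trans (sum-mono _ _ λ i → lem i (any? (R? i))) (≤-reflexive (∑-comm λ i j → 𝟙 (R? i j)))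
  where
  lem : ∀ i (d : Dec _) → 𝟙 d ≤ count (R? i)
  lem i (yes (j , q)) = count-≥1 (R? i) j q
  lem i (no _) = z≤n

val-injective : {i j : Fin n} → val i ≡ val j → i ≡ j
val-injective e = toℕ-injective (cong pred e)

count-val-≤1 : {P : Pred (Fin n) 0ℓ} (P? : Decidable P) → (∀ i j → P i → P j → val i ≡ val j) → count P? ≤ 1
count-val-≤1 P? h = count-≤1 P? λ i j p q → val-injective (h i j p q)

-- Any of the three may be the sum, which makes the edge relation symmetric.
Sum₃ : Fin n → Fin n → Fin n → Set
Sum₃ u v w = (u ≢ v × v ≢ w × u ≢ w) ×
             (val u + val v ≡ val w ⊎ val u + val w ≡ val v ⊎ val v + val w ≡ val u)

sum₃? : (u v w : Fin n) → Dec (Sum₃ u v w)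
sum₃? u v w = (¬? (u ≟F v) ×-dec ¬? (v ≟F w) ×-dec ¬? (u ≟F w)) ×-dec
  ((val u + val v ≟ val w) ⊎-dec (val u + val w ≟ val v) ⊎-dec (val v + val w ≟ val u))

Sum₃-swap : {u v w : Fin n} → Sum₃ u v w → Sum₃ v u w
Sum₃-swap {u = u} {v} ((a , b , c) , s) = (a ∘ sym , c , b) , (case s of λ where
  (inj₁ e) → inj₁ (trans (+-comm (val v) (val u)) e)
  (inj₂ (inj₁ e)) → inj₂ (inj₂ e)
  (inj₂ (inj₂ e)) → inj₂ (inj₁ e))

Sum₃-rotate : {u v w : Fin n} → Sum₃ u v w → Sum₃ u w v
Sum₃-rotate {v = v} {w} ((a , b , c) , s) = (c , b ∘ sym , a) , (case s of λ where
  (inj₁ e) → inj₂ (inj₁ e)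
  (inj₂ (inj₁ e)) → inj₁ e
  (inj₂ (inj₂ e)) → inj₂ (inj₂ (trans (+-comm (val w) (val v)) e)))

count-Sum₃ : (u w : Fin n) → count (λ v → sum₃? u v w) ≤ 3
count-Sum₃ {n} u w = ≤-trans
  (count-≤-+ (λ v → sum₃? u v w) a? (λ v → b? v ⊎-dec c? v) λ _ → proj₂)
  (+-mono-≤ (count-val-≤1 a? λ i j p q → +-cancelˡ-≡ (val u) _ _ (trans p (sym q)))
    (≤-trans (count-⊎ b? c?) (+-mono-≤
      (count-val-≤1 b? λ i j p q → trans (sym p) q)
      (count-val-≤1 c? λ i j p q → +-cancelʳ-≡ (val w) _ _ (trans p (sym q))))))
  where
  a? = λ (v : Fin n) → val u + val v ≟ val w
  b? = λ (v : Fin n) → val u + val w ≟ val v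
  c? = λ (v : Fin n) → val v + val w ≟ val u

-- That is, the value of `v` is the absolute difference of those of `u` and `w`.
Differ : Fin n → Fin n → Fin n → Set
Differ w u v = val u + val v ≡ val w ⊎ val w + val v ≡ val u

differ? : (w u v : Fin n) → Dec (Differ w u v)
differ? w u v = (val u + val v ≟ val w) ⊎-dec (val w + val v ≟ val u)

difference : (w u : Fin n) → toℕ u < toℕ w → ∃[ v ] val u + val v ≡ val w
-- Values are indices plus one, so the difference of the two values has index `toℕ w ∸ suc (toℕ u)`.
difference {n} w u u<w = fromℕ< d<n , trans (cong (λ x → val u + suc x) (toℕ-fromℕ< d<n)) eq
  where
  d<n : toℕ w ∸ suc (toℕ u) < n
  d<n = ≤-<-trans (m∸n≤m (toℕ w) (suc (toℕ u))) (toℕ<n w)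
  eq : val u + suc (toℕ w ∸ suc (toℕ u)) ≡ val w
  eq = trans (+-suc (val u) _) (cong suc (m+[n∸m]≡n u<w))

a+b≢a : (u : Fin n) (a : ℕ) → val u + a ≢ a
a+b≢a u a e = m≢1+n+m a (sym e)

-- These are the `u` whose absolute difference with `w` is zero, `u` itself or `w`, so that no sum
-- of three distinct elements arises.
Degenerate : Fin n → Fin n → Set
Degenerate w u = u ≡ w ⊎ val u + val u ≡ val w ⊎ val w + val w ≡ val u

degenerate? : (w : Fin n) → Decidable (Degenerate w)
degenerate? w u = (u ≟F w) ⊎-dec (val u + val u ≟ val w) ⊎-dec (val w + val w ≟ val u)

partner : (w u : Fin n) → ¬ Degenerate w u → ∃[ v ] Differ w u v × Sum₃ u v w
partner w u ¬d with <-cmp (toℕ u) (toℕ w)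
... | tri≈ _ e _ = contradiction (inj₁ (toℕ-injective e)) ¬d
... | tri< u<w _ _ with v , e ← difference w u u<w =
  v , inj₁ e , ((λ { refl → ¬d (inj₂ (inj₁ e)) }) , (λ { refl → a+b≢a u _ e }) , ¬d ∘ inj₁) , inj₁ e
... | tri> _ _ w<u with v , e ← difference u w w<u =
  v , inj₂ e , ((λ { refl → a+b≢a w _ e }) , (λ { refl → ¬d (inj₂ (inj₂ e)) }) , ¬d ∘ inj₁) ,
  inj₂ (inj₂ (trans (+-comm (val v) (val w)) e))

count-degenerate : (w : Fin n) → count (degenerate? w) ≤ 3
count-degenerate {n} w = ≤-trans (count-⊎ (_≟F w) _)
  (+-mono-≤ (count-≤1 (_≟F w) λ _ _ p q → trans p (sym q))
    (≤-trans (count-⊎ a? b?) (+-mono-≤ (count-val-≤1 a? λ i j p q → double-injective _ _ (trans p (sym q)))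
                                       (count-val-≤1 b? λ i j p q → trans (sym p) q))))
  where
  a? = λ (u : Fin n) → val u + val u ≟ val w
  b? = λ (u : Fin n) → val w + val w ≟ val u
  double-injective : ∀ a b → a + a ≡ b + b → a ≡ b
  double-injective a b e with <-cmp a b
  ... | tri< l _ _ = contradiction e (<⇒≢ (+-mono-< l l))
  ... | tri≈ _ e _ = e
  ... | tri> _ _ l = contradiction (sym e) (<⇒≢ (+-mono-< l l))

count-Differ : (w v : Fin n) → count (λ u → differ? w u v) ≤ 2
count-Differ {n} w v = ≤-trans (count-⊎ a? b?)
  (+-mono-≤ (count-val-≤1 a? λ i j p q → +-cancelʳ-≡ (val v) _ _ (trans p (sym q)))
            (count-val-≤1 b? λ i j p q → trans (sym p) q))
  where
  a? = λ (u : Fin n) → val u + val v ≟ val w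
  b? = λ (u : Fin n) → val w + val v ≟ val u

module _ {G : Pred (Fin n) 0ℓ} (G? : Decidable G) (w : Fin n) where

  Partnered : Pred (Fin n) 0ℓ
  Partnered u = G u × ∃[ v ] G v × Sum₃ u v w

  partnered? : Decidable Partnered
  partnered? u = G? u ×-dec any? λ v → G? v ×-dec sum₃? u v w

  -- Each v outside G spoils at most two u, and the degenerate u are w, w/2 and 2w.
  count-unpartnered : count (¬? ∘ partnered?) ≤ 3 * count (¬? ∘ G?) + 3
  count-unpartnered = begin
    count (¬? ∘ partnered?)            ≤⟨ count-mono _ (λ u → ¬G? u ⊎-dec bad? u ⊎-dec degenerate? w u) split ⟩
    count (λ u → ¬G? u ⊎-dec bad? u ⊎-dec degenerate? w u)
      ≤⟨ ≤-trans (count-⊎ ¬G? _) (+-monoʳ-≤ β (count-⊎ bad? (degenerate? w))) ⟩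
    β + (count bad? + count (degenerate? w)) ≤⟨ +-monoʳ-≤ β (+-mono-≤ bad≤ (count-degenerate w)) ⟩
    β + (β * 2 + 3)                    ≡⟨ solve 1 (λ β → β :+ (β :* con 2 :+ con 3) := con 3 :* β :+ con 3) refl β ⟩
    3 * β + 3                          ∎
    where
    open ≤-Reasoning
    open +-*-Solver
    ¬G? = ¬? ∘ G?
    β = count ¬G?
    bad? = λ u → any? λ v → ¬G? v ×-dec differ? w u v
    bad≤ : count bad? ≤ β * 2
    bad≤ = ≤-trans (count-∃ λ u v → ¬G? v ×-dec differ? w u v)
      (sum-drop _ 2 ¬G?
        (λ v → ≤-trans (count-mono (λ u → ¬G? v ×-dec differ? w u v) (λ u → differ? w u v) λ _ → proj₂) (count-Differ w v))
        (λ v ¬¬g → count-none (λ u → ¬G? v ×-dec differ? w u v) λ u q → ¬¬g (proj₁ q)))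
    split : ∀ u → ¬ Partnered u → ¬ G u ⊎ (∃[ v ] ¬ G v × Differ w u v) ⊎ Degenerate w u
    split u ¬p with G? u | degenerate? w u
    ... | no ¬g | _     = inj₁ ¬g
    ... | yes _ | yes d = inj₂ (inj₂ d)
    ... | yes g | no ¬d with v , e , s ← partner w u ¬d = inj₂ (inj₁ (v , (λ g′ → ¬p (g , v , g′ , s)) , e))

  count-partnered : n ≤ count partnered? + (3 * count (¬? ∘ G?) + 3)
  count-partnered = ≤-trans (count-complement partnered?) (+-monoʳ-≤ (count partnered?) count-unpartnered)

-- The hypergraph of rainbow sums

Distinct : Fin r → Fin r → Fin r → Set
Distinct a b c = a ≢ b × b ≢ c × a ≢ c

-- The vertex (i , a) is combine i a.
module Rainbow (n r : ℕ) where

  pos : Fin (n * r) → Fin n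
  pos = quotient r

  col : Fin (n * r) → Fin r
  col = remainder {n} r

  pos-combine : ∀ i (a : Fin r) → pos (combine i a) ≡ i
  pos-combine i a = cong proj₁ (remQuot-combine i a)

  col-combine : ∀ (i : Fin n) a → col (combine i a) ≡ a
  col-combine i a = cong proj₂ (remQuot-combine i a)

  h : Fin (n * r) → Fin (n * r) → Fin (n * r) → Set
  h u v w = Sum₃ (pos u) (pos v) (pos w) × Distinct (col u) (col v) (col w)

  h? : ∀ u v w → Dec (h u v w)
  h? u v w = sum₃? (pos u) (pos v) (pos w) ×-dec
    (¬? (col u ≟F col v) ×-dec ¬? (col v ≟F col w) ×-dec ¬? (col u ≟F col w))

  h-sym : ∀ u v w → h u v w → h v u w
  h-sym u v w (s , a , b , c) = Sum₃-swap s , a ∘ sym , c , b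

  private
    h-intro : ∀ x y z {u v w c d a} → pos x ≡ u → pos y ≡ v → pos z ≡ w → col x ≡ c → col y ≡ d → col z ≡ a →
              Sum₃ u v w → Distinct c d a → h x y z
    h-intro x y z refl refl refl refl refl refl s t = s , t

  h-combine : ∀ u v w c d a → Sum₃ u v w → Distinct c d a → h (combine u c) (combine v d) (combine w a)
  h-combine u v w c d a = h-intro _ _ _ (pos-combine u c) (pos-combine v d) (pos-combine w a)
                                        (col-combine u c) (col-combine v d) (col-combine w a)

  module _ {Q : Pred (Fin n) 0ℓ} (Q? : Decidable Q) {R : Pred (Fin (n * r)) 0ℓ} (R? : Decidable R)
           (R⇒Q : ∀ v → R v → Q (pos v)) where

    count-fibre : count R? ≤ count Q? * r
    count-fibre = ≤-trans (≤-reflexive (sum-combine {n} (𝟙 ∘ R?)))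
      (sum-drop _ r Q?
        (λ i → ≤-trans (sum-≤-const _ 1 λ a → 𝟙≤1 (R? (combine i a))) (≤-reflexive (*-identityʳ r)))
        (λ i ¬q → count-none (λ a → R? (combine i a)) λ a ρ → ¬q (subst Q (pos-combine i a) (R⇒Q _ ρ))))

  codeg : ∀ u w → count (λ v → h? u v w) ≤ 3 * r
  codeg u w = ≤-trans (count-fibre (λ i → sum₃? (pos u) i (pos w)) (λ v → h? u v w) λ _ → proj₁)
                      (*-monoˡ-≤ r (count-Sum₃ (pos u) (pos w)))

  codeg′ : ∀ u v → count (h? u v) ≤ 3 * r
  codeg′ u v = ≤-trans (count-fibre (λ i → sum₃? (pos u) (pos v) i) (h? u v) λ _ → proj₁)
    (*-monoˡ-≤ r (≤-trans (count-mono _ (λ i → sum₃? (pos u) i (pos v)) λ _ → Sum₃-rotate) (count-Sum₃ (pos u) (pos v))))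

  open Container h? h-sym (3 * r) codeg codeg′ public

  -- Different positions `u` give different first vertices `combine u c`, so each of them
  -- contributes its own ordered pair.
  codegᵖ-≥ : {P : Pred (Fin (n * r)) 0ℓ} (P? : Decidable P) {X : Pred (Fin n) 0ℓ} (X? : Decidable X) (w : Fin n) (a : Fin r) →
    (∀ u → X u → ∃[ v ] ∃[ c ] ∃[ d ] P (combine u c) × P (combine v d) × Sum₃ u v w × Distinct c d a) →
    count X? ≤ codegᵖ P? (combine w a)
  codegᵖ-≥ {P} P? X? w a wit = ≤-trans (sum-mono _ _ λ u → lem u (X? u))
    (≤-reflexive (sym (sum-combine {n} λ u → sum λ v → 𝟙 (P? u ×-dec P? v ×-dec h? u v (combine w a)))))
    where
    lem : ∀ u (d : Dec _) → 𝟙 d ≤ sum λ c → sum λ v → 𝟙 (P? (combine u c) ×-dec P? v ×-dec h? (combine u c) v (combine w a))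
    lem u (no _) = z≤n
    lem u (yes x) with v , c , d , p , q , s , t ← wit u x =
      ≤-trans (count-≥1 (λ v → P? (combine u c) ×-dec P? v ×-dec h? (combine u c) v (combine w a)) (combine v d)
                (p , q , h-combine u v w c d a s t))
              (term≤sum (λ c → sum λ v → 𝟙 (P? (combine u c) ×-dec P? v ×-dec h? (combine u c) v (combine w a))) c)

-- Leaves of the container algorithm

filter-filter-≤ : {X : Set} {P Q : Pred X 0ℓ} (P? : Decidable P) (Q? : Decidable Q) (xs : List X) →
  length (filter P? (filter Q? xs)) ≤ length (filter (λ x → P? x ×-dec Q? x) xs)
filter-filter-≤ P? Q? [] = z≤n
filter-filter-≤ P? Q? (x ∷ xs) = ≤-trans (head (Q? x)) (≤-reflexive (sym (length-filter-∷ PQ? x xs)))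
  where
  PQ? = λ x → P? x ×-dec Q? x
  ih = filter-filter-≤ P? Q? xs
  head : Dec _ → length (filter P? (filter Q? (x ∷ xs))) ≤ 𝟙 (PQ? x) + length (filter PQ? xs)
  head (no ¬q) = ≤-trans (≤-reflexive (cong (length ∘ filter P?) (filter-reject Q? ¬q))) (≤-trans ih (m≤n+m _ _))
  head (yes q) = ≤-trans (≤-reflexive (trans (cong (length ∘ filter P?) (filter-accept Q? q)) (length-filter-∷ P? x _)))
                         (+-mono-≤ (𝟙-mono (P? x) (PQ? x) (_, q)) ih)

-- `RainbowSumFree` places the sum last while `Sum₃` leaves its place open; the three cases reorder
-- the triple.
rainbow-free : (A : Subset n) (c : Colouring r n) → RainbowSumFree A c → Coloured A c →
  ∀ {u v w a b d} → Sum₃ u v w → lookup c u ≡ just a → lookup c v ≡ just b → lookup c w ≡ just d → ¬ Distinct a b d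
rainbow-free A c rsf (_ , dom) {u} {v} {w} {a} {b} {d} ((u≢v , v≢w , u≢w) , s) cu cv cw (a≢b , b≢d , a≢d) = case s of λ where
    (inj₁ e) → rsf u v w u∈ v∈ w∈ u≢v v≢w u≢w e (neq cu cv a≢b , neq cv cw b≢d , neq cu cw a≢d)
    (inj₂ (inj₁ e)) → rsf u w v u∈ w∈ v∈ u≢w (v≢w ∘ sym) u≢v e (neq cu cw a≢d , neq cw cv (b≢d ∘ sym) , neq cu cv a≢b)
    (inj₂ (inj₂ e)) → rsf v w u v∈ w∈ u∈ v≢w (u≢w ∘ sym) (u≢v ∘ sym) e
                          (neq cv cw b≢d , neq cw cu (a≢d ∘ sym) , neq cv cu (a≢b ∘ sym))
  where
  u∈ = dom u a cu
  v∈ = dom v b cv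
  w∈ = dom w d cw
  neq : ∀ {x y : Maybe (Fin _)} {a b} → x ≡ just a → y ≡ just b → a ≢ b → x ≢ y
  neq p q a≢b e = a≢b (just-injective (trans (sym p) (trans e q)))

module Matching {n r : ℕ} (A : Subset n) (w : Fin n) (a b₁ b₂ : Fin r)
  (b₁≢b₂ : b₁ ≢ b₂) (a≢b₁ : a ≢ b₁) (a≢b₂ : a ≢ b₂) where

  Fixed : Colouring r n → Set
  Fixed c = RainbowSumFree A c × lookup c w ≡ just a

  fixed? : Decidable Fixed
  fixed? c = rainbowSumFree? A c ×-dec ≡-decMaybe _≟F_ (lookup c w) (just a)

  fixed-count : {Q : Fin n → Fin r → Set} → (∀ i → Decidable (Q i)) → ℕ
  fixed-count Q? = length (filter (λ c → within? Q? c ×-dec fixed? c) (colorings r A))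

  module _ {Q : Fin n → Fin r → Set} (Q? : ∀ i → Decidable (Q i)) (u v : Fin n) (b : Fin r) where

    merge? : ∀ i → Decidable λ c → Q i c × (i ≡ u ⊎ i ≡ v → c ≡ b)
    merge? i c = Q? i c ×-dec ((i ≟F u ⊎-dec i ≟F v) →-dec (c ≟F b))

    merge≤ : ∀ i → count (merge? i) ≤ count (Q? i)
    merge≤ i = count-mono _ (Q? i) λ _ → proj₁

  -- G consists of positions with available colours b₁ and b₂ only. Since w has colour a, partners u and v in G must
  -- agree; splitting on their common colour costs a factor 2 but removes two positions from E.
  matching : ∀ k {Q : Fin n → Fin r → Set} (Q? : ∀ i → Decidable (Q i))
    {G E : Pred (Fin n) 0ℓ} (G? : Decidable G) (E? : Decidable E) →
    (∀ i → count (Q? i) ≤ 2) → (∀ i → ¬ E i → count (Q? i) ≤ 1) → (∀ i → G i → E i) →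
    (∀ i → G i → i ∈ A × (∀ c → Q i c → c ≡ b₁ ⊎ c ≡ b₂)) →
    3 * count (¬? ∘ G?) + 3 + 6 * k ≤ n → fixed-count Q? * 2 ^ k ≤ 2 ^ count E?
  matching zero Q? G? E? le₂ le₁ G⊆E G-two room = ≤-trans (≤-reflexive (*-identityʳ _))
    (≤-trans (filter-mono _ (within? Q?) (colorings r A) λ _ → proj₁) (within-count A Q? E? 2 le₂ le₁))
  matching (suc k) {Q} Q? {G} {E} G? E? le₂ le₁ G⊆E G-two room
    -- By `room`, `3 * count (¬? ∘ G?) + 3` is less than `n`, so `count-partnered` leaves some
    -- partnered `u`.
    with count-witness (partnered? G? w) (+-cancelʳ-≤ (3 * count (¬? ∘ G?) + 3) _ _
           (≤-trans (≤-trans (≤-reflexive (+-comm 1 (3 * count (¬? ∘ G?) + 3)))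
                             (≤-trans (+-monoʳ-≤ (3 * count (¬? ∘ G?) + 3) (s≤s z≤n)) room)) (count-partnered G? w)))
  ... | u , gu , v , gv , s@((u≢v , v≢w , u≢w) , _) = begin
    fixed-count Q? * 2 ^ suc k              ≤⟨ *-monoˡ-≤ (2 ^ suc k) split ⟩
    (N₁ + N₂) * (2 * 2 ^ k)                 ≡⟨ solve 3 (λ a b c → (a :+ b) :* (con 2 :* c) := con 2 :* (a :* c :+ b :* c)) refl N₁ N₂ (2 ^ k) ⟩
    2 * (N₁ * 2 ^ k + N₂ * 2 ^ k)           ≤⟨ *-monoʳ-≤ 2 (+-mono-≤ (ih b₁) (ih b₂)) ⟩
    -- Two positions leave `E`, a factor of 4: a factor 2 pays for the two cases and another for the
    -- step from `k` to `suc k`.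
    2 * (2 ^ count E′? + 2 ^ count E′?)     ≡⟨ solve 1 (λ a → con 2 :* (a :+ a) := a :* con 4) refl (2 ^ count E′?) ⟩
    2 ^ count E′? * 2 ^ 2                   ≡⟨ ^-distribˡ-+-* 2 (count E′?) 2 ⟨
    2 ^ (count E′? + 2)                     ≤⟨ ^-monoʳ-≤ 2 E-drop ⟩
    2 ^ count E?                            ∎
    where
    open ≤-Reasoning
    open +-*-Solver
    N₁ = fixed-count (merge? Q? u v b₁)
    N₂ = fixed-count (merge? Q? u v b₂)
    G′? = (G? ∖ u) ∖ v
    E′? = (E? ∖ u) ∖ v
    E-drop : count E′? + 2 ≤ count E?
    E-drop = ≤-trans (≤-reflexive (sym (+-assoc (count E′?) 1 1)))
      (≤-trans (+-monoˡ-≤ 1 (count-remove (E? ∖ u) v (G⊆E v gv , u≢v ∘ sym))) (count-remove E? u (G⊆E u gu)))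
    G-drop : count (¬? ∘ G′?) ≤ count (¬? ∘ G?) + 2
    G-drop = ≤-trans (count-≤-+ (¬? ∘ G′?) (¬? ∘ G?) (λ i → i ≟F u ⊎-dec i ≟F v) out)
      (+-monoʳ-≤ (count (¬? ∘ G?)) (≤-trans (count-⊎ (_≟F u) (_≟F v))
        (+-mono-≤ (count-≤1 (_≟F u) λ _ _ p q → trans p (sym q)) (count-≤1 (_≟F v) λ _ _ p q → trans p (sym q)))))
      where
      out : ∀ i → ¬ ((G i × i ≢ u) × i ≢ v) → ¬ G i ⊎ (i ≡ u ⊎ i ≡ v)
      out i ¬g with i ≟F u | i ≟F v
      ... | yes p | _ = inj₂ (inj₁ p)
      ... | no _ | yes p = inj₂ (inj₂ p)
      ... | no p | no q = inj₁ λ g → ¬g ((g , p) , q)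
    ih : ∀ b → fixed-count (merge? Q? u v b) * 2 ^ k ≤ 2 ^ count E′?
    ih b = matching k (merge? Q? u v b) G′? E′? (λ i → ≤-trans (merge≤ Q? u v b i) (le₂ i)) le₁′
      (λ i ((g , p) , q) → (G⊆E i g , p) , q)
      (λ i ((g , _) , _) → proj₁ (G-two i g) , λ c (q , _) → proj₂ (G-two i g) c q)
      -- Losing two positions of `G` raises `3 * count (¬? ∘ G?)` by at most 6, hence the 6 per
      -- round.
      (≤-trans (≤-trans (+-monoˡ-≤ (6 * k) (+-monoˡ-≤ 3 (*-monoʳ-≤ 3 G-drop)))
        (≤-reflexive (solve 2 (λ a k → con 3 :* (a :+ con 2) :+ con 3 :+ con 6 :* k := con 3 :* a :+ con 3 :+ con 6 :* (con 1 :+ k))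
                       refl (count (¬? ∘ G?)) k))) room)
      where
      le₁′ : ∀ i → ¬ ((E i × i ≢ u) × i ≢ v) → count (merge? Q? u v b i) ≤ 1
      le₁′ i ¬e = case (i ≟F u) , (i ≟F v) of λ where
        (yes p , _) → count-≤1 (merge? Q? u v b i) λ _ _ (_ , f) (_ , g) → trans (f (inj₁ p)) (sym (g (inj₁ p)))
        (no _ , yes p) → count-≤1 (merge? Q? u v b i) λ _ _ (_ , f) (_ , g) → trans (f (inj₂ p)) (sym (g (inj₂ p)))
        (no p , no q) → ≤-trans (merge≤ Q? u v b i) (le₁ i λ e → ¬e ((e , p) , q))
    split : fixed-count Q? ≤ N₁ + N₂
    split = filter-≤-+ _ _ _ (colorings r A) both
      where
      agree : ∀ c {b} → Within Q c → lookup c u ≡ just b → lookup c v ≡ just b →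
              Within (λ i c → Q i c × (i ≡ u ⊎ i ≡ v → c ≡ b)) c
      agree c q cu cv i z e = q i z e , λ { (inj₁ refl) → just-injective (trans (sym e) cu)
                                        ; (inj₂ refl) → just-injective (trans (sym e) cv) }
      both : ∀ {c} → c ∈ˡ colorings r A → Within Q c × Fixed c →
             (Within _ c × Fixed c) ⊎ (Within _ c × Fixed c)
      both {c} m (q , fx@(rsf , cw)) with dom ← colorings-coloured A m
        with x , cu ← proj₁ dom u (proj₁ (G-two u gu)) | y , cv ← proj₁ dom v (proj₁ (G-two v gv))
        with proj₂ (G-two u gu) x (q u x cu) | proj₂ (G-two v gv) y (q v y cv)
      ... | inj₁ refl | inj₁ refl = inj₁ (agree c q cu cv , fx)
      ... | inj₂ refl | inj₂ refl = inj₂ (agree c q cu cv , fx)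
      -- If `u` and `v` disagreed, they would form a rainbow sum with `w`, whose colour is `a`.
      ... | inj₁ refl | inj₂ refl = contradiction (b₁≢b₂ , a≢b₂ ∘ sym , a≢b₁ ∘ sym) (rainbow-free A c rsf dom s cu cv cw)
      ... | inj₂ refl | inj₁ refl = contradiction (b₁≢b₂ ∘ sym , a≢b₁ ∘ sym , a≢b₂ ∘ sym) (rainbow-free A c rsf dom s cu cv cw)

module Colourings (r n : ℕ) .{{_ : NonZero r}} (A : Subset n) where

  open Rainbow n r

  family : List (Colouring r n)
  family = filter (multiColoured? A) (colorings r A)

  Uses : Colouring r n → Fin (n * r) → Set
  Uses c v = lookup c (pos v) ≡ just (col v)

  uses? : ∀ c v → Dec (Uses c v)
  uses? c v = ≡-decMaybe _≟F_ (lookup c (pos v)) (just (col v))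

  uses-combine : ∀ c {i a} → lookup c i ≡ just a → Uses c (combine i a)
  uses-combine c {i} {a} e = trans (cong (lookup c) (pos-combine i a)) (trans e (cong just (sym (col-combine i a))))

  uses-combine⁻¹ : ∀ c {i a} → Uses c (combine i a) → lookup c i ≡ just a
  uses-combine⁻¹ c {i} {a} e = trans (cong (lookup c) (sym (pos-combine i a))) (trans e (cong just (col-combine i a)))

  independent : ∀ c u v w → c ∈ˡ family → h u v w → Uses c u → Uses c v → ¬ Uses c w
  independent c u v w m (s , d) cu cv cw with c∈ , rsf , _ ← ∈-filter⁻ (multiColoured? A) m =
    rainbow-free A c rsf (colorings-coloured A c∈) s cu cv cw d

  open IndependentFamily h? h-sym (3 * r) codeg codeg′ uses? family independent public

  module Leaf {P F : Pred (Fin (n * r)) 0ℓ} (P? : Decidable P) (F? : Decidable F) (s : ℕ)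
              (light : ∀ w → P w → ¬ F w → codegᵖ P? w < s) where

    -- If (z , a) is forced, no other colour is available at z.
    Q : Fin n → Fin r → Set
    Q z b = (z ∈ A × P (combine z b)) × (∀ a → F (combine z a) → a ≡ b)

    Q? : ∀ z → Decidable (Q z)
    Q? z b = ((z ∈? A) ×-dec P? (combine z b)) ×-dec all? λ a → F? (combine z a) →-dec (a ≟F b)

    Double : Pred (Fin n) 0ℓ
    Double z = 2 ≤ count (Q? z)

    double? : Decidable Double
    double? z = 2 ≤? count (Q? z)

    Good : Colouring r n → Set
    Good c = Between P F c × RainbowSumFree A c × All (λ p → ¬ TwoColoured p c) (pairs r)

    good? : Decidable Good
    good? c = between? P? F? c ×-dec multiColoured? A c

    N≤good : N P? F? ≤ length (filter good? (colorings r A))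
    N≤good = filter-filter-≤ (between? P? F?) (multiColoured? A) (colorings r A)

    good-within : ∀ {c} → c ∈ˡ colorings r A → Good c → Within Q c
    good-within {c} m ((p , f) , _) i a e =
      (proj₂ (colorings-coloured A m) i a e , p _ (uses-combine c e)) ,
      λ b fb → just-injective (trans (sym (uses-combine⁻¹ c (f _ fb))) e)

    N≤within : ∀ {E : Pred (Fin n) 0ℓ} (E? : Decidable E) k .{{_ : NonZero k}} →
      (∀ i → count (Q? i) ≤ k) → (∀ i → ¬ E i → count (Q? i) ≤ 1) → N P? F? ≤ k ^ count E?
    N≤within E? k le₂ le₁ = ≤-trans N≤good (≤-trans (filter-mono good? (within? Q?) (colorings r A) good-within)
                                                    (within-count A Q? E? k le₂ le₁))

    count-Q≤r : ∀ z → count (Q? z) ≤ r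
    count-Q≤r z = ≤-trans (sum-≤-const _ 1 λ a → 𝟙≤1 (Q? z a)) (≤-reflexive (*-identityʳ r))

    fixed-single : ∀ z a → F (combine z a) → count (Q? z) ≤ 1
    fixed-single z a fa = count-≤1 (Q? z) λ b b′ q q′ → trans (sym (proj₂ q a fa)) (proj₂ q′ a fa)

    -- By `fixed-single` no vertex at a double position is forced, so `light` bounds the codegree of
    -- each available vertex there by `s`; summing over the colours at `w` gives `r * s`.
    rainbow-count : ∀ w → Double w → {X : Pred (Fin n) 0ℓ} (X? : Decidable X) →
      (∀ u → X u → ∃[ v ] ∃[ a ] ∃[ c ] ∃[ d ] Q w a × Q u c × Q v d × Sum₃ u v w × Distinct c d a) →
      count X? ≤ r * s
    rainbow-count w dw X? wit = ≤-trans
      (count-mono X? (λ u → any? λ a → Y? u a) λ u x → case wit u x of λ (v , a , c , d , q) → a , v , c , d , q)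
      (≤-trans (count-∃ Y?) (sum-≤-const {r} _ s light-colour))
      where
      Y? : ∀ u → Decidable λ a → ∃[ v ] ∃[ c ] ∃[ d ] Q w a × Q u c × Q v d × Sum₃ u v w × Distinct c d a
      Y? u a = any? λ v → any? λ c → any? λ d → Q? w a ×-dec Q? u c ×-dec Q? v d ×-dec sum₃? u v w ×-dec
               (¬? (c ≟F d) ×-dec ¬? (d ≟F a) ×-dec ¬? (c ≟F a))
      light-colour : ∀ a → count (λ u → Y? u a) ≤ s
      light-colour a = case Q? w a of λ where
        (no ¬q) → ≤-trans (≤-reflexive (count-none (λ u → Y? u a) λ { u (_ , _ , _ , q , _) → ¬q q })) z≤n
        (yes ((_ , p) , _)) → ≤-trans
          (codegᵖ-≥ P? (λ u → Y? u a) w a λ { u (v , c , d , _ , ((_ , pu) , _) , ((_ , pv) , _) , t) → v , c , d , pu , pv , t })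
          (<⇒≤ (light (combine w a) p λ f → <⇒≱ dw (fixed-single w a f)))

    -- A rainbow triple can be chosen greedily: any `d` at the partner `v`, then one of two colours
    -- at `u`, then one of three at `w`. Hence a double `u` is either among the `r * s` of
    -- `rainbow-count` or has no partner in `A`.
    triple-doubles : (∀ z → z ∈ A → 1 ≤ count (Q? z)) → ∀ w → 3 ≤ count (Q? w) →
      count double? ≤ r * s + (3 * count (λ i → ¬? (i ∈? A)) + 3)
    triple-doubles nonempty w three = ≤-trans
      (count-≤-+ double? X? (¬? ∘ partnered? (_∈? A) w) λ u d → case partnered? (_∈? A) w u of λ where
        (yes p) → inj₁ (d , p)
        (no ¬p) → inj₂ ¬p)
      (+-mono-≤ (rainbow-count w (≤-trans (n≤1+n 2) three) X? wit) (count-unpartnered (_∈? A) w))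
      where
      X? = λ u → double? u ×-dec partnered? (_∈? A) w u
      wit : ∀ u → Double u × Partnered (_∈? A) w u →
            ∃[ v ] ∃[ a ] ∃[ c ] ∃[ d ] Q w a × Q u c × Q v d × Sum₃ u v w × Distinct c d a
      wit u (dbl , u∈ , v , v∈ , sm)
        with d , qd ← count-witness (Q? v) (nonempty v v∈)
        with c , qc , c≢d ← count-avoid₁ (Q? u) dbl d
        with a , qa , a≢c , a≢d ← count-avoid₂ (Q? w) three c d =
        v , a , c , d , qa , qc , qd , sm , c≢d , a≢d ∘ sym , a≢c ∘ sym

    module Pair (le₂ : ∀ z → count (Q? z) ≤ 2) (w₀ : Fin n) (dw : Double w₀) (b₁ b₂ : Fin r)
                (q₁ : Q w₀ b₁) (q₂ : Q w₀ b₂) (b₁≢b₂ : b₁ ≢ b₂) where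

      Full : Pred (Fin n) 0ℓ
      Full u = Q u b₁ × Q u b₂

      full? : Decidable Full
      full? u = Q? u b₁ ×-dec Q? u b₂

      full-double : ∀ u → Full u → Double u
      full-double u (p , q) = ≤-trans (+-mono-≤ (count-≥1 (_≟F b₁) b₁ refl) (count-≥1 (_≟F b₂) b₂ refl))
        (count-+-≤ (Q? u) (_≟F b₁) (_≟F b₂) (λ { _ refl → p }) (λ { _ refl → q }) λ { _ refl e → b₁≢b₂ e })

      full-two : ∀ u → Full u → ∀ c → Q u c → c ≡ b₁ ⊎ c ≡ b₂
      full-two u (p , q) c qc with c ≟F b₁ | c ≟F b₂
      ... | yes e | _     = inj₁ e
      ... | no _  | yes e = inj₂ e
      ... | no c≢b₁ | no c≢b₂ = contradiction
        (≤-trans (+-mono-≤ (+-mono-≤ (count-≥1 (_≟F b₁) b₁ refl) (count-≥1 (_≟F b₂) b₂ refl)) (count-≥1 (_≟F c) c refl))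
          (≤-trans (+-monoˡ-≤ (count (_≟F c)) (count-+-≤ X? (_≟F b₁) (_≟F b₂)
                      (λ _ → inj₁) (λ _ → inj₂) λ { _ refl e → b₁≢b₂ e }))
            (count-+-≤ (Q? u) X? (_≟F c) (λ { _ (inj₁ refl) → p ; _ (inj₂ refl) → q }) (λ { _ refl → qc })
              λ { _ (inj₁ refl) e → c≢b₁ (sym e) ; _ (inj₂ refl) e → c≢b₂ (sym e) })))
        (<⇒≱ (s≤s (le₂ u)))
        where X? = λ i → (i ≟F b₁) ⊎-dec (i ≟F b₂)

      third-colour : ∀ u → Double u → ¬ Full u → ∃[ c ] Q u c × c ≢ b₁ × c ≢ b₂
      third-colour u dbl ¬full
        with c , qc , c≢b₁ ← count-avoid₁ (Q? u) dbl b₁ | c ≟F b₂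
      ... | no c≢b₂ = c , qc , c≢b₁ , c≢b₂
      ... | yes refl with d , qd , d≢b₂ ← count-avoid₁ (Q? u) dbl b₂ | d ≟F b₁
      ...   | no d≢b₁ = d , qd , d≢b₁ , d≢b₂
      ...   | yes refl = contradiction (qd , qc) ¬full

      -- If `u` is double but not full, with a double partner `v`, then a third colour at `u`
      -- extends to a rainbow triple with `v` and `w₀`, and `rainbow-count` applies.
      count-¬full : count (¬? ∘ full?) ≤ r * s + (3 * count (¬? ∘ double?) + 3)
      count-¬full = ≤-trans
        (count-≤-+ (¬? ∘ full?) X? (¬? ∘ partnered? double? w₀) λ u ¬f → case partnered? double? w₀ u of λ where
          (yes p) → inj₁ (¬f , p)
          (no ¬p) → inj₂ ¬p)
        (+-mono-≤ (rainbow-count w₀ dw X? wit) (count-unpartnered double? w₀))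
        where
        X? = λ u → ¬? (full? u) ×-dec partnered? double? w₀ u
        wit : ∀ u → ¬ Full u × Partnered double? w₀ u →
              ∃[ v ] ∃[ a ] ∃[ c ] ∃[ d ] Q w₀ a × Q u c × Q v d × Sum₃ u v w₀ × Distinct c d a
        wit u (¬f , du , v , dv , sm)
          with c , qc , c≢b₁ , c≢b₂ ← third-colour u du ¬f
          with d , qd , d≢c ← count-avoid₁ (Q? v) dv c
          -- At `w₀` one of `b₁` and `b₂` differs from `d`, and `c` differs from both.
          with d ≟F b₁
        ... | no d≢b₁ = v , b₁ , c , d , q₁ , qc , qd , sm , d≢c ∘ sym , d≢b₁ , c≢b₁
        ... | yes refl = v , b₂ , c , d , q₂ , qc , qd , sm , d≢c ∘ sym , b₁≢b₂ , c≢b₂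

      -- Every colouring at the leaf would use only `b₁` and `b₂`, but the family excludes
      -- two-coloured members.
      no-third-colour : ¬ (∃[ w ] ∃[ a ] Q w a × a ≢ b₁ × a ≢ b₂) → N P? F? ≡ 0
      no-third-colour none = n≤0⇒n≡0 (≤-trans N≤good (≤-reflexive (filter-zero good? (colorings r A) bad)))
        where
        bad : ∀ {c} → c ∈ˡ colorings r A → ¬ Good c
        bad {c} m gd@(_ , _ , multi) = case pairs-complete b₁ b₂ b₁≢b₂ of λ where
            (inj₁ p) → lookupAll multi p two
            (inj₂ p) → lookupAll multi p λ i a e → case two i a e of λ where
              (inj₁ e) → inj₂ e
              (inj₂ e) → inj₁ e
          where
          two : Within (λ _ d → d ≡ b₁ ⊎ d ≡ b₂) c
          two i a e with a ≟F b₁ | a ≟F b₂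
          ... | yes p | _ = inj₁ p
          ... | no _ | yes p = inj₂ p
          ... | no p | no q = contradiction (i , a , good-within m gd i a e , p , q) none

      -- Every full `u` with a full partner gives an edge with colours `b₁`, `b₂`, `a`. There are at
      -- least `s` of these, too many for an unforced vertex.
      third-colour-fixed : ∀ w a → Q w a → a ≢ b₁ → a ≢ b₂ → s + (3 * count (¬? ∘ full?) + 3) ≤ n → F (combine w a)
      third-colour-fixed w a ((_ , p) , _) a≢b₁ a≢b₂ room with F? (combine w a)
      ... | yes f = f
      ... | no ¬f = contradiction (≤-trans room (count-partnered full? w)) (<⇒≱ (+-monoˡ-< (3 * count (¬? ∘ full?) + 3)
        (≤-<-trans (codegᵖ-≥ P? (partnered? full? w) w a
          λ { u ((((_ , p₁) , _) , _) , v , (_ , ((_ , p₂) , _)) , sm) → v , b₁ , b₂ , p₁ , p₂ , sm , b₁≢b₂ , a≢b₂ ∘ sym , a≢b₁ ∘ sym })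
          (light (combine w a) p ¬f))))

      -- A forced vertex is used by every colouring at the leaf, so all of them give `w` the colour
      -- `a` and `matching` applies to the full positions.
      fixed-third-colour : ∀ w a → F (combine w a) → a ≢ b₁ → a ≢ b₂ → ∀ K →
        3 * count (¬? ∘ full?) + 3 + 6 * K ≤ n → N P? F? * 2 ^ K ≤ 2 ^ n
      fixed-third-colour w a f a≢b₁ a≢b₂ K room = ≤-trans
        (*-monoˡ-≤ (2 ^ K) (≤-trans N≤good (filter-mono good? (λ c → within? Q? c ×-dec fixed? c) (colorings r A)
          λ {c} m gd@((_ , use) , rsf , _) → good-within m gd , rsf , uses-combine⁻¹ c (use _ f))))
        (≤-trans (matching K Q? full? double? le₂ (λ i ¬d → ≤-pred (≰⇒> ¬d)) full-double
                   (λ i fl → proj₁ (proj₁ (proj₁ fl)) , full-two i fl) room)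
          (^-monoʳ-≤ 2 (≤-trans (m≤m+n (count double?) _) (count-+-complement≤ double?))))
        where open Matching A w a b₁ b₂ b₁≢b₂ a≢b₁ a≢b₂

    -- If a position of `A` has no available colour, the leaf is empty. If one has three, few
    -- positions are double and the fourth hypothesis suffices. If at least `K` positions are not
    -- double, these save `2 ^ K`. Otherwise `β` bounds the number of positions that are not full,
    -- and either no third colour is available or `matching` saves `2 ^ K`.
    leaf-bound : (K e : ℕ) → e + K ≡ n → r ^ (r * s + (3 * count (λ i → ¬? (i ∈? A)) + 3)) ≤ 2 ^ e →
      (let β = r * s + (3 * K + 3)) → s + (3 * β + 3) ≤ n → 3 * β + 3 + 6 * K ≤ n → N P? F? ≤ 2 ^ e
    leaf-bound K e refl small room₁ room₂ =
      case any? (λ z → (z ∈? A) ×-dec (count (Q? z) ≟ 0)) of λ where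
        (yes (z , z∈ , empty)) → ≤-trans (≤-trans N≤good (≤-reflexive (filter-zero good? (colorings r A)
          λ m gd → case proj₁ (colorings-coloured A m) z z∈ of λ (a , e) →
            <⇒≱ (count-≥1 (Q? z) a (good-within m gd z a e)) (≤-reflexive empty)))) z≤n
        (no ¬empty) → case any? (λ w → 3 ≤? count (Q? w)) of λ where
          (yes (w , three)) → ≤-trans
            (≤-trans (N≤within double? r count-Q≤r single)
                     (^-monoʳ-≤ r (triple-doubles (λ z z∈ → n≢0⇒n>0 λ e → ¬empty (z , z∈ , e)) w three)))
            small
          (no ¬three) → no-triple λ z → ≤-pred (≰⇒> λ t → ¬three (z , t))
      where
      single : ∀ i → ¬ Double i → count (Q? i) ≤ 1
      single i ¬d = ≤-pred (≰⇒> ¬d)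
      mostly-double : (∀ z → count (Q? z) ≤ 2) → count (¬? ∘ double?) < K → N P? F? ≤ 2 ^ e
      mostly-double le₂ β<K
        -- Fewer than `K ≤ n` positions fail to be double, so some position is.
        with w₀ , dw ← count-witness double? (+-cancelʳ-< _ 0 (count double?) (<-≤-trans β<K (≤-trans (m≤n+m K e) (count-complement double?))))
        with b₁ , q₁ ← count-witness (Q? w₀) (≤-trans (s≤s z≤n) dw)
        with b₂ , q₂ , b₂≢b₁ ← count-avoid₁ (Q? w₀) dw b₁ =
        case any? (λ w → any? λ a → Q? w a ×-dec ¬? (a ≟F b₁) ×-dec ¬? (a ≟F b₂)) of λ where
          (no none) → ≤-trans (≤-reflexive (no-third-colour none)) z≤n
          (yes (w , a , q , a≢b₁ , a≢b₂)) → *-cancelʳ-≤ _ _ (2 ^ K) {{m^n≢0 2 K}}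
            (≤-trans (fixed-third-colour w a
                       (third-colour-fixed w a q a≢b₁ a≢b₂ (≤-trans (+-monoʳ-≤ s (+-monoˡ-≤ 3 (*-monoʳ-≤ 3 ¬full≤))) room₁))
                       a≢b₁ a≢b₂ K (≤-trans (+-monoˡ-≤ (6 * K) (+-monoˡ-≤ 3 (*-monoʳ-≤ 3 ¬full≤))) room₂))
                     (≤-reflexive (^-distribˡ-+-* 2 e K)))
        where
        open Pair le₂ w₀ dw b₁ b₂ q₁ q₂ (b₂≢b₁ ∘ sym)
        ¬full≤ : count (¬? ∘ full?) ≤ r * s + (3 * K + 3)
        ¬full≤ = ≤-trans count-¬full (+-monoʳ-≤ (r * s) (+-monoˡ-≤ 3 (*-monoʳ-≤ 3 (<⇒≤ β<K))))
      no-triple : (∀ z → count (Q? z) ≤ 2) → N P? F? ≤ 2 ^ e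
      no-triple le₂ = case K ≤? count (¬? ∘ double?) of λ where
        (yes K≤) → ≤-trans (N≤within double? 2 le₂ single)
          (^-monoʳ-≤ 2 (+-cancelʳ-≤ K _ _ (≤-trans (+-monoʳ-≤ (count double?) K≤) (count-+-complement≤ double?))))
        (no K≰) → mostly-double le₂ (≰⇒> K≰)

-- Estimates for powers and the logarithmic error term

^-distribʳ-* : ∀ x y m → (x * y) ^ m ≡ x ^ m * y ^ m
^-distribʳ-* x y zero    = refl
^-distribʳ-* x y (suc m) = trans (cong (x * y *_) (^-distribʳ-* x y m))
  (solve 4 (λ x y a b → x :* y :* (a :* b) := x :* a :* (y :* b)) refl x y (x ^ m) (y ^ m))
  where open +-*-Solver

^-cancelˡ-≤ : ∀ m .{{_ : NonZero m}} {a b} → a ^ m ≤ b ^ m → a ≤ b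
^-cancelˡ-≤ m {a} {b} le = ≮⇒≥ λ b<a → <⇒≱ (^-monoˡ-< m b<a) le

-- The mean value estimate for the power `suc k` between `t` and `suc t`.
suc-^-≤ : ∀ t k → suc t ^ suc k ≤ t ^ suc k + suc k * suc t ^ k
suc-^-≤ t zero    = ≤-reflexive (solve 1 (λ t → (con 1 :+ t) :* con 1 := t :* con 1 :+ con 1 :* con 1) refl t)
  where open +-*-Solver
suc-^-≤ t (suc k) = begin
  suc t * y                                            ≡⟨⟩
  y + t * y                                            ≤⟨ +-monoʳ-≤ y (*-monoʳ-≤ t (suc-^-≤ t k)) ⟩
  y + t * (t ^ suc k + suc k * suc t ^ k)              ≡⟨ cong (y +_) (*-distribˡ-+ t (t ^ suc k) _) ⟩
  y + (t ^ suc (suc k) + t * (suc k * suc t ^ k))      ≤⟨ +-monoʳ-≤ y (+-monoʳ-≤ (t ^ suc (suc k)) (*-monoˡ-≤ _ (n≤1+n t))) ⟩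
  y + (t ^ suc (suc k) + suc t * (suc k * suc t ^ k))  ≡⟨ solve 4 (λ t k a b →
    (con 1 :+ t) :* a :+ (b :+ (con 1 :+ t) :* ((con 1 :+ k) :* a)) := b :+ (con 2 :+ k) :* ((con 1 :+ t) :* a))
    refl t k (suc t ^ k) (t ^ suc (suc k)) ⟩
  t ^ suc (suc k) + suc (suc k) * y                    ∎
  where open ≤-Reasoning
        open +-*-Solver
        y = suc t ^ suc k

-- As `suc t = 2 * m`, the error term in `suc-^-≤` is exactly half of `suc t ^ m`.
double-^ : ∀ t m → suc t ≡ 2 * m → suc t ^ m ≤ 2 * t ^ m
double-^ t zero    e = s≤s z≤n
double-^ t (suc k) e = +-cancelʳ-≤ (suc t ^ suc k) _ _ (begin
  suc t ^ suc k + suc t ^ suc k                     ≤⟨ +-mono-≤ (suc-^-≤ t k) (suc-^-≤ t k) ⟩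
  (a + suc k * b) + (a + suc k * b)                 ≡⟨ solve 3 (λ a k b → (a :+ k :* b) :+ (a :+ k :* b) := con 2 :* a :+ con 2 :* k :* b) refl a (suc k) b ⟩
  2 * a + 2 * suc k * b                             ≡⟨ cong (λ x → 2 * a + x * b) (sym e) ⟩
  2 * a + suc t ^ suc k                             ∎)
  where open ≤-Reasoning
        open +-*-Solver
        a = t ^ suc k
        b = suc t ^ k

-- With t + 1 = 2m one has (1 + 1/t)^m ≤ 2, so taking m-th powers turns the factor ((t + 1)/t)^V into 2^(V/m) ≤ 2^q.
extract-bound : ∀ t m κ V J L q e → suc t ≡ 2 * m → suc t ≡ 2 ^ κ → 0 < t → V ≤ m * q → κ * J ≡ 2 * q →
                t ^ V * L ≤ suc t ^ (V + J) * 2 ^ e → L ≤ 2 ^ (3 * q + e)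
extract-bound t zero κ V J L q e ()
extract-bound t m@(suc _) κ V J L q e t≡2m t≡2^κ 0<t V≤ κJ≡ le =
  ^-cancelˡ-≤ m (*-cancelˡ-≤ ((t ^ V) ^ m) {{m^n≢0 (t ^ V) m {{m^n≢0 t V {{>-nonZero 0<t}}}}}} (begin
    (t ^ V) ^ m * L ^ m                               ≡⟨ ^-distribʳ-* (t ^ V) L m ⟨
    (t ^ V * L) ^ m                                   ≤⟨ ^-monoˡ-≤ m le ⟩
    (suc t ^ (V + J) * 2 ^ e) ^ m                     ≡⟨ cong (λ x → (x * 2 ^ e) ^ m) (^-distribˡ-+-* (suc t) V J) ⟩
    (suc t ^ V * suc t ^ J * 2 ^ e) ^ m               ≡⟨ cong (_^ m) (*-assoc (suc t ^ V) _ _) ⟩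
    (suc t ^ V * (suc t ^ J * 2 ^ e)) ^ m             ≡⟨ ^-distribʳ-* (suc t ^ V) _ m ⟩
    (suc t ^ V) ^ m * (suc t ^ J * 2 ^ e) ^ m         ≤⟨ *-mono-≤ ratio (≤-reflexive (cong (λ x → (x * 2 ^ e) ^ m) tJ)) ⟩
    ((t ^ V) ^ m * 2 ^ (q * m)) * (2 ^ (2 * q) * 2 ^ e) ^ m
      ≡⟨ *-assoc ((t ^ V) ^ m) (2 ^ (q * m)) ((2 ^ (2 * q) * 2 ^ e) ^ m) ⟩
    (t ^ V) ^ m * (2 ^ (q * m) * (2 ^ (2 * q) * 2 ^ e) ^ m)
      ≡⟨ cong ((t ^ V) ^ m *_) (trans (cong₂ _*_ (sym (^-*-assoc 2 q m)) refl) (sym (^-distribʳ-* (2 ^ q) _ m))) ⟩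
    (t ^ V) ^ m * (2 ^ q * (2 ^ (2 * q) * 2 ^ e)) ^ m ≡⟨ cong (λ x → (t ^ V) ^ m * x ^ m) powers ⟩
    (t ^ V) ^ m * (2 ^ (3 * q + e)) ^ m               ∎))
  where
  open ≤-Reasoning
  open +-*-Solver
  swap-^ : ∀ a x y → (a ^ x) ^ y ≡ (a ^ y) ^ x
  swap-^ a x y = trans (^-*-assoc a x y) (trans (cong (a ^_) (*-comm x y)) (sym (^-*-assoc a y x)))
  ratio : (suc t ^ V) ^ m ≤ (t ^ V) ^ m * 2 ^ (q * m)
  ratio = begin
    (suc t ^ V) ^ m           ≡⟨ swap-^ (suc t) V m ⟩
    (suc t ^ m) ^ V           ≤⟨ ^-monoˡ-≤ V (double-^ t m t≡2m) ⟩
    (2 * t ^ m) ^ V           ≡⟨ ^-distribʳ-* 2 (t ^ m) V ⟩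
    2 ^ V * (t ^ m) ^ V       ≤⟨ *-monoˡ-≤ _ (^-monoʳ-≤ 2 (≤-trans V≤ (≤-reflexive (*-comm m q)))) ⟩
    2 ^ (q * m) * (t ^ m) ^ V ≡⟨ cong (2 ^ (q * m) *_) (swap-^ t m V) ⟩
    2 ^ (q * m) * (t ^ V) ^ m ≡⟨ *-comm (2 ^ (q * m)) _ ⟩
    (t ^ V) ^ m * 2 ^ (q * m) ∎
  tJ : suc t ^ J ≡ 2 ^ (2 * q)
  tJ = trans (cong (_^ J) t≡2^κ) (trans (^-*-assoc 2 κ J) (cong (2 ^_) κJ≡))
  powers : 2 ^ q * (2 ^ (2 * q) * 2 ^ e) ≡ 2 ^ (3 * q + e)
  powers = trans (cong (2 ^ q *_) (sym (^-distribˡ-+-* 2 (2 * q) e)))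
    (trans (sym (^-distribˡ-+-* 2 q (2 * q + e)))
      (cong (2 ^_) (solve 2 (λ q e → q :+ (con 2 :* q :+ e) := con 3 :* q :+ e) refl q e)))

m<2^m : ∀ m → m < 2 ^ m
m<2^m zero    = s≤s z≤n
m<2^m (suc m) = ≤-trans (+-mono-≤ (m^n>0 2 m) (m<2^m m)) (≤-reflexive (cong (2 ^ m +_) (sym (+-identityʳ (2 ^ m)))))

-- The rational p / b bounds log₂ n from above, and n ≥ 2^c makes it larger than c.
saving⇒BoundByPow : ∀ n c q x → 2 ^ c ≤ n → n ≤ 2 * (c * q) → x * 2 ^ q ≤ 2 ^ n → BoundByPow n x
saving⇒BoundByPow n c q x big n≤ le p b 0<b n^b<2^p = begin
  x ^ (26 * p) * 2 ^ (n * b)           ≤⟨ *-monoʳ-≤ (x ^ (26 * p)) (^-monoʳ-≤ 2 nb≤) ⟩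
  x ^ (26 * p) * 2 ^ (q * (26 * p))    ≡⟨ cong (x ^ (26 * p) *_) (^-*-assoc 2 q (26 * p)) ⟨
  x ^ (26 * p) * (2 ^ q) ^ (26 * p)    ≡⟨ ^-distribʳ-* x (2 ^ q) (26 * p) ⟨
  (x * 2 ^ q) ^ (26 * p)               ≤⟨ ^-monoˡ-≤ (26 * p) le ⟩
  (2 ^ n) ^ (26 * p)                   ≡⟨ ^-*-assoc 2 n (26 * p) ⟩
  2 ^ (n * (26 * p))                   ≡⟨ cong (2 ^_) (*-comm n (26 * p)) ⟩
  2 ^ (26 * p * n)                     ∎
  where
  open ≤-Reasoning
  open +-*-Solver
  cb≤p : c * b ≤ p
  -- Otherwise `2 ^ p ≤ 2 ^ (c * b) ≤ n ^ b`, against `n ^ b < 2 ^ p`.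
  cb≤p = ≮⇒≥ λ p<cb → <-irrefl refl (≤-<-trans (≤-trans (^-monoʳ-≤ 2 (<⇒≤ p<cb))
    (≤-trans (≤-reflexive (sym (^-*-assoc 2 c b))) (^-monoˡ-≤ b big))) n^b<2^p)
  nb≤ : n * b ≤ q * (26 * p)
  nb≤ = begin
    n * b              ≤⟨ *-monoˡ-≤ b n≤ ⟩
    2 * (c * q) * b    ≡⟨ solve 3 (λ c q b → con 2 :* (c :* q) :* b := q :* (con 2 :* (c :* b))) refl c q b ⟩
    -- The 26 absorbs the factor 2 from `n ≤ 2 * (c * q)`.
    q * (2 * (c * b))  ≤⟨ *-monoʳ-≤ q (*-mono-≤ {2} {26} (s≤s (s≤s z≤n)) cb≤p) ⟩
    q * (26 * p)       ∎

-- Choice of parameters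

-- With `suc t = 2 ^ κ = 2 * m`, the codegree threshold is `q`, of order `n / c`, and the budget is
-- `J = 2 * s`. Then `suc t ^ J` is `2 ^ (2 * q)`, and `n * r ≤ m * q` bounds
-- `(suc t / t) ^ (n * r)` by `2 ^ q`.
module Parameters (r n c κ m D s q : ℕ) (A : Subset n) (3≤r : 3 ≤ r)
  (dense : (r ^ 3) * n ≤ (r ^ 3) * ∣ A ∣ + n)
  (c≡ : c ≡ 3 * (r * r) + 9 * r + 73) (D≡ : D ≡ 2 * (r * c) * κ) (q≡ : q ≡ κ * s)
  (2m≡ : 2 * m ≡ 2 ^ κ) (2rc≤m : 2 * (r * c) ≤ m) (0<q : 0 < q) (0<D : 0 < D)
  (cq≤n : c * q ≤ n) (n≤2cq : n ≤ 2 * (c * q)) (s-large : 4 * (3 * r * suc D) * (r * c) ≤ s)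
  where

  open ≤-Reasoning
  open +-*-Solver

  private instance
    r≢0 : NonZero r
    r≢0 = >-nonZero (≤-trans (s≤s z≤n) 3≤r)

  open Colourings r n A

  private
    D′ = 3 * r * suc D
    X = 2 * D′ * D + q

    nr≤ : n * r ≤ D * s
    nr≤ = begin
      n * r                 ≤⟨ *-monoˡ-≤ r n≤2cq ⟩
      2 * (c * q) * r       ≡⟨ cong (λ x → 2 * (c * x) * r) q≡ ⟩
      2 * (c * (κ * s)) * r ≡⟨ solve 4 (λ c κ s r → con 2 :* (c :* (κ :* s)) :* r := con 2 :* (r :* c) :* κ :* s) refl c κ s r ⟩
      2 * (r * c) * κ * s   ≡⟨ cong (_* s) D≡ ⟨
      D * s                 ∎

    2D′nr≤ : 2 * D′ * (n * r) ≤ s * q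
    2D′nr≤ = begin
      2 * D′ * (n * r)             ≤⟨ *-monoʳ-≤ (2 * D′) (*-monoˡ-≤ r n≤2cq) ⟩
      2 * D′ * (2 * (c * q) * r)   ≡⟨ solve 4 (λ D′ c q r → con 2 :* D′ :* (con 2 :* (c :* q) :* r) := con 4 :* D′ :* (r :* c) :* q) refl D′ c q r ⟩
      4 * D′ * (r * c) * q         ≤⟨ *-monoˡ-≤ q s-large ⟩
      s * q                        ∎

    -- The two summands of `X` use half of the budget each: `2 * D′ * D` because `s` is large, and
    -- `q` because of the choice of `D`.
    budget : X * (n * r) ≤ 2 * s * (D * q)
    budget = begin
      (2 * D′ * D + q) * (n * r)                 ≡⟨ solve 4 (λ D′ D q v → (con 2 :* D′ :* D :+ q) :* v := D :* (con 2 :* D′ :* v) :+ q :* v) refl D′ D q (n * r) ⟩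
      D * (2 * D′ * (n * r)) + q * (n * r)       ≤⟨ +-mono-≤ (*-monoʳ-≤ D 2D′nr≤) (*-monoʳ-≤ q nr≤) ⟩
      D * (s * q) + q * (D * s)                  ≡⟨ solve 3 (λ D s q → D :* (s :* q) :+ q :* (D :* s) := con 2 :* s :* (D :* q)) refl D s q ⟩
      2 * s * (D * q)                            ∎

    -- A leaf saves `2 ^ (4 * q)` and the number of leaves costs `2 ^ (3 * q)`, so `2 ^ q` remains.
    K = 4 * q
    e = n ∸ K

    -- The coefficients 3, 9 and 73 in `c` dominate those of all size conditions below; additive
    -- constants are first multiplied by `q` through `pad`.
    linear : ∀ a b d → a ≤ 3 → b ≤ 9 → d ≤ 73 → (a * (r * r) + b * r + d) * q ≤ n
    linear a b d a≤ b≤ d≤ = begin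
      (a * (r * r) + b * r + d) * q ≤⟨ *-monoˡ-≤ q (+-mono-≤ (+-mono-≤ (*-monoˡ-≤ (r * r) a≤) (*-monoˡ-≤ r b≤)) d≤) ⟩
      (3 * (r * r) + 9 * r + 73) * q ≡⟨ cong (_* q) c≡ ⟨
      c * q                          ≤⟨ cq≤n ⟩
      n                              ∎

    pad : ∀ k → k ≤ k * q
    pad k = m≤m*n k q {{>-nonZero 0<q}}

    K≤n : K ≤ n
    K≤n = linear 0 0 4 z≤n z≤n (m≤m+n 4 69)

    βA = count (λ i → ¬? (i ∈? A))

    -- The only use of the density of A; r ≥ 3 makes r³ ≥ 9r.
    9rβ≤n : 9 * r * βA ≤ n
    9rβ≤n = begin
      9 * r * βA  ≤⟨ *-monoˡ-≤ βA 9r≤r³ ⟩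
      r ^ 3 * βA  ≤⟨ +-cancelˡ-≤ (r ^ 3 * ∣ A ∣) _ _ (≤-trans (≤-trans
                       (≤-reflexive (sym (*-distribˡ-+ (r ^ 3) ∣ A ∣ βA))) (*-monoʳ-≤ (r ^ 3) (count-∉ A))) dense) ⟩
      n           ∎
      where
      9r≤r³ : 9 * r ≤ r ^ 3
      9r≤r³ = begin
        3 * 3 * r  ≤⟨ *-monoˡ-≤ r (*-mono-≤ 3≤r 3≤r) ⟩
        r * r * r  ≡⟨ solve 1 (λ r → r :* r :* r := r :* (r :* (r :* con 1))) refl r ⟩
        r ^ 3      ∎

    -- Three times the left side splits into terms in `q`, a term for the elements missing from `A`,
    -- and `9 * r`; each part is at most `n`.
    exponent : r * (r * q + (3 * βA + 3)) + K ≤ n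
    exponent = *-cancelˡ-≤ 3 (begin
      3 * (r * (r * q + (3 * βA + 3)) + 4 * q)
        ≡⟨ solve 3 (λ r q β → con 3 :* (r :* (r :* q :+ (con 3 :* β :+ con 3)) :+ con 4 :* q)
                    := (con 3 :* (r :* r) :+ con 12) :* q :+ con 9 :* r :* β :+ con 9 :* r) refl r q βA ⟩
      (3 * (r * r) + 12) * q + 9 * r * βA + 9 * r
        ≤⟨ +-mono-≤ (+-mono-≤ (≤-trans (*-monoˡ-≤ q (+-monoˡ-≤ 12 (m≤m+n (3 * (r * r)) 0)))
                                        (linear 3 0 12 ≤-refl z≤n (m≤m+n 12 61))) 9rβ≤n)
                    (≤-trans (pad (9 * r)) (≤-trans (*-monoˡ-≤ q (m≤m+n (9 * r) 0)) (linear 0 9 0 z≤n ≤-refl z≤n))) ⟩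
      n + n + n  ≡⟨ solve 1 (λ n → n :+ n :+ n := con 3 :* n) refl n ⟩
      3 * n      ∎)

    small : r ^ (r * q + (3 * βA + 3)) ≤ 2 ^ e
    small = begin
      -- Bounding `r` by `2 ^ r` puts a factor `r` in the exponent, for which `exponent` leaves
      -- room.
      r ^ (r * q + (3 * βA + 3))         ≤⟨ ^-monoˡ-≤ (r * q + (3 * βA + 3)) (<⇒≤ (m<2^m r)) ⟩
      (2 ^ r) ^ (r * q + (3 * βA + 3))   ≡⟨ ^-*-assoc 2 r _ ⟩
      2 ^ (r * (r * q + (3 * βA + 3)))   ≤⟨ ^-monoʳ-≤ 2 (m+n≤o⇒m≤o∸n (r * (r * q + (3 * βA + 3))) exponent) ⟩
      2 ^ e                              ∎

    room₁ : q + (3 * (r * q + (3 * K + 3)) + 3) ≤ n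
    room₁ = begin
      q + (3 * (r * q + (3 * (4 * q) + 3)) + 3)
        ≡⟨ solve 2 (λ r q → q :+ (con 3 :* (r :* q :+ (con 3 :* (con 4 :* q) :+ con 3)) :+ con 3)
                      := (con 3 :* r :+ con 37) :* q :+ con 12) refl r q ⟩
      (3 * r + 37) * q + 12        ≤⟨ +-monoʳ-≤ ((3 * r + 37) * q) (pad 12) ⟩
      (3 * r + 37) * q + 12 * q    ≡⟨ solve 2 (λ r q → (con 3 :* r :+ con 37) :* q :+ con 12 :* q := (con 0 :* (r :* r) :+ con 3 :* r :+ con 49) :* q) refl r q ⟩
      (0 * (r * r) + 3 * r + 49) * q ≤⟨ linear 0 3 49 z≤n (m≤m+n 3 6) (m≤m+n 49 24) ⟩
      n ∎

    room₂ : 3 * (r * q + (3 * K + 3)) + 3 + 6 * K ≤ n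
    room₂ = begin
      3 * (r * q + (3 * (4 * q) + 3)) + 3 + 6 * (4 * q)
        ≡⟨ solve 2 (λ r q → con 3 :* (r :* q :+ (con 3 :* (con 4 :* q) :+ con 3)) :+ con 3 :+ con 6 :* (con 4 :* q)
                      := (con 3 :* r :+ con 60) :* q :+ con 12) refl r q ⟩
      (3 * r + 60) * q + 12        ≤⟨ +-monoʳ-≤ ((3 * r + 60) * q) (pad 12) ⟩
      (3 * r + 60) * q + 12 * q    ≡⟨ solve 2 (λ r q → (con 3 :* r :+ con 60) :* q :+ con 12 :* q := (con 0 :* (r :* r) :+ con 3 :* r :+ con 72) :* q) refl r q ⟩
      (0 * (r * r) + 3 * r + 72) * q ≤⟨ linear 0 3 72 z≤n (m≤m+n 3 6) (m≤m+n 72 1) ⟩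
      n ∎

  family-saving : length family * 2 ^ q ≤ 2 ^ n
  family-saving = begin
    length family * 2 ^ q       ≤⟨ *-monoˡ-≤ (2 ^ q) (extract-bound t m κ (n * r) (2 * s) (length family) q e
                                     t≡2m (trans t≡2m 2m≡) 0<t V≤ κJ (family-bound D q t (2 ^ e) 0<3r 0<D 0<q
                                       (λ P? F? light → Leaf.leaf-bound P? F? q light K e (m∸n+n≡m K≤n) small room₁ room₂)
                                       (2 * s) budget)) ⟩
    2 ^ (3 * q + e) * 2 ^ q     ≡⟨ ^-distribˡ-+-* 2 (3 * q + e) q ⟨
    2 ^ (3 * q + e + q)         ≡⟨ cong (2 ^_) (trans (solve 2 (λ q e → con 3 :* q :+ e :+ q := e :+ con 4 :* q) refl q e) (m∸n+n≡m K≤n)) ⟩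
    2 ^ n                       ∎
    where
    t = 2 * m ∸ 1
    0<3r : 0 < 3 * r
    0<3r = *-mono-≤ {1} {3} (s≤s z≤n) (≤-trans (s≤s z≤n) 3≤r)
    0<c : 0 < c
    0<c = ≤-trans (s≤s z≤n) (≤-trans (m≤n+m 73 _) (≤-reflexive (sym c≡)))
    0<m : 0 < m
    0<m = ≤-trans (*-mono-≤ {1} {2} (s≤s z≤n) (*-mono-≤ (≤-trans (s≤s z≤n) 3≤r) 0<c)) 2rc≤m
    t≡2m : suc t ≡ 2 * m
    t≡2m = m+[n∸m]≡n (*-mono-≤ {1} {2} (s≤s z≤n) 0<m)
    0<t : 0 < t
    0<t = m<n⇒0<n∸m (*-mono-≤ {2} {2} ≤-refl 0<m)
    V≤ : n * r ≤ m * q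
    V≤ = begin
      n * r             ≤⟨ *-monoˡ-≤ r n≤2cq ⟩
      2 * (c * q) * r   ≡⟨ solve 3 (λ c q r → con 2 :* (c :* q) :* r := con 2 :* (r :* c) :* q) refl c q r ⟩
      2 * (r * c) * q   ≤⟨ *-monoˡ-≤ q 2rc≤m ⟩
      m * q             ∎
    κJ : κ * (2 * s) ≡ 2 * q
    κJ = trans (solve 2 (λ κ s → κ :* (con 2 :* s) := con 2 :* (κ :* s)) refl κ s) (cong (2 *_) (sym q≡))

-- All constants depend on `r` alone, and only `s` and `q` depend on `n`. Here `s₀` is the lower
-- bound on `s` required by `s-large`.
dense-bound : ∀ r c k κ D s₀ → c ≡ 3 * (r * r) + 9 * r + 73 → k ≡ 2 * (r * c) → κ ≡ suc k → D ≡ k * κ →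
  s₀ ≡ suc (4 * (3 * r * suc D) * (r * c)) → 3 ≤ r → ∀ n → 2 ^ c + s₀ * (c * κ) ≤ n → (A : Subset n) →
  (r ^ 3) * n ≤ (r ^ 3) * ∣ A ∣ + n → LeWithError n (g A r) ((r C 2) * 2 ^ ∣ A ∣)
dense-bound r c k κ D s₀ c≡ k≡ κ≡ D≡ s₀≡ 3≤r n n₀≤n A dense =
  saving⇒BoundByPow n c q _ (m+n≤o⇒m≤o (2 ^ c) n₀≤n) n≤2cq
    (≤-trans (*-monoˡ-≤ (2 ^ q) (m≤n+o⇒m∸n≤o (g A r) ((r C 2) * 2 ^ ∣ A ∣) (g-≤ A r)))
      (Parameters.family-saving r n c κ (2 ^ k) D s q A 3≤r dense c≡ (trans D≡ (cong (_* κ) k≡)) refl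
        (cong (2 ^_) (sym κ≡)) (≤-trans (≤-reflexive (sym k≡)) (<⇒≤ (m<2^m k))) 0<q 0<D
        cq≤n n≤2cq (≤-trans (n≤1+n _) (≤-trans (≤-reflexive (sym s₀≡)) s₀≤s))))
  where
  open ≤-Reasoning
  open +-*-Solver
  0<c : 0 < c
  0<c = subst (0 <_) (sym c≡) (≤-trans (s≤s z≤n) (m≤n+m 73 (3 * (r * r) + 9 * r)))
  0<κ : 0 < κ
  0<κ = subst (0 <_) (sym κ≡) (s≤s z≤n)
  instance
    cκ≢0 : NonZero (c * κ)
    cκ≢0 = >-nonZero (*-mono-≤ 0<c 0<κ)
  s = n / (c * κ)
  -- A multiple of `κ`, so that `κ * (2 * s) = 2 * q` holds exactly.
  q = κ * s
  s₀≤s : s₀ ≤ s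
  s₀≤s = ≤-trans (≤-reflexive (sym (m*n/n≡m s₀ (c * κ)))) (/-monoˡ-≤ (c * κ) (m+n≤o⇒n≤o (2 ^ c) n₀≤n))
  0<s : 0 < s
  0<s = ≤-trans (subst (0 <_) (sym s₀≡) (s≤s z≤n)) s₀≤s
  0<q : 0 < q
  0<q = *-mono-≤ 0<κ 0<s
  0<D : 0 < D
  0<D = subst (0 <_) (sym D≡) (*-mono-≤ (subst (0 <_) (sym k≡)
          (*-mono-≤ {1} {2} (s≤s z≤n) (*-mono-≤ (≤-trans (s≤s z≤n) 3≤r) 0<c))) 0<κ)
  s-expand : s * (c * κ) ≡ c * q
  s-expand = solve 3 (λ s c κ → s :* (c :* κ) := c :* (κ :* s)) refl s c κ
  cq≤n : c * q ≤ n
  cq≤n = ≤-trans (≤-reflexive (sym s-expand)) (m/n*n≤m n (c * κ))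
  n≤2cq : n ≤ 2 * (c * q)
  n≤2cq = begin
    n                           ≡⟨ m≡m%n+[m/n]*n n (c * κ) ⟩
    n % (c * κ) + s * (c * κ)   ≤⟨ +-mono-≤ (<⇒≤ (m%n<n n (c * κ))) ≤-refl ⟩
    -- As `s` is positive, rounding `n / (c * κ)` down costs at most a factor 2.
    c * κ + s * (c * κ)         ≤⟨ +-monoˡ-≤ _ (m≤n*m (c * κ) s {{>-nonZero 0<s}}) ⟩
    s * (c * κ) + s * (c * κ)   ≡⟨ cong (λ x → x + x) s-expand ⟩
    c * q + c * q               ≡⟨ cong (c * q +_) (sym (+-identityʳ (c * q))) ⟩
    2 * (c * q)                 ∎

mainTheorem1 : (r : ℕ) → r ≥ 3 →
    ∃[ n₀ ] ((n : ℕ) → n₀ < n → (A : Subset n) →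
    (r ^ 3) * n ≤ (r ^ 3) * ∣ A ∣ + n →
    LeWithError n (g A r) ((r C 2) * 2 ^ ∣ A ∣))
-- The first summand ensures `log₂ n ≥ c`, the second `s ≥ s₀`.
mainTheorem1 r r≥3 = 2 ^ c + s₀ * (c * κ) , λ n n₀<n →
    dense-bound r c k κ D s₀ refl refl refl refl refl r≥3 n (<⇒≤ n₀<n)
  where
  c = 3 * (r * r) + 9 * r + 73
  -- This gives `2 * (r * c) ≤ 2 ^ k`, where `2 ^ k` serves as `m`.
  k = 2 * (r * c)
  κ = suc k
  D = k * κ
  s₀ = suc (4 * (3 * r * suc D) * (r * c))
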